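{- If $\mathcal{P}$ is an order-hereditary property of vertex $k$-colourings of the hypercubes $Q_n$, with $\mathcal{P}_n\ne\emptyset$ for every $n$, then $$|\mathcal{P}_n|=k^{\left(\pi_v^{\mathbf{Q}}(\mathcal{P})+o(1)\right)2^n}\qquad(n\to\infty).$$
   Context: $k\ge2$ is a fixed integer, $[k]=\{1,\dots,k\}$, and $Q_n$ denotes the $n$-dimensional hypercube with vertex set $\{0,1\}^n$. For $m\le n$, an order-preserving embedding of $Q_m$ into $Q_n$ is a map $\phi:\{0,1\}^m\to\{0,1\}^n$ for which there is an $m$-set $B=\{b_1<\dots<b_m\}\subseteq[n]$ such that $\phi(\mathbf{x})_{b_j}=\mathbf{x}_j$ for all $j$, and $\phi(\mathbf{x})_i=\phi(\mathbf{0})_i$ for $i\notin B$. An order-hereditary property of vertex $k$-colourings of hypercubes is a sequence $\mathcal{P}=(\mathcal{P}_n)_n$, where $\mathcal{P}_n$ is a set of maps $c:\{0,1\}^n\to[k]$, such that $c\circ\phi\in\mathcal{P}_m$ for every $c\in\mathcal{P}_n$ and every order-preserving embedding $\phi:Q_m\to Q_n$. A vertex template for $Q_n$ is a function $t$ assigning to each $\mathbf{x}\in\{0,1\}^n$ a nonempty set $t(\mathbf{x})\subseteq[k]$; $\langle t\rangle$ is the set of $c:\{0,1\}^n\to[k]$ with $c(\mathbf{x})\in t(\mathbf{x})$ for all $\mathbf{x}$; $\mathrm{Ent}(t)=\sum_{\mathbf{x}}\log_k|t(\mathbf{x})|$. $\mathrm{ex}(Q_n,\mathcal{P})=\max\{\mathrm{Ent}(t):\langle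 t\rangle\subseteq\mathcal{P}_n\}$, and $\pi_v^{\mathbf{Q}}(\mathcal{P})=\lim_{n\to\infty}\mathrm{ex}(Q_n,\mathcal{P})/2^n$ (the limit exists). -}

module Defs where

open import Data.Bool.Base using (Bool; true; false)
open import Data.Fin.Base as Fin using (Fin)
open import Data.Fin.Subset as Subset using (Subset; _∈_; ∣_∣)
open import Data.Fin.Subset.Properties using (x∈p⇒∣p-x∣<∣p∣)
open import Data.Integer.Base as ℤ using (ℤ; +_; -[1+_])
import Data.Integer.Properties as ℤₚ
open import Data.Nat.Base as ℕ using (ℕ; zero; suc; z≤n; s≤s)
import Data.Nat.Properties as ℕₚ
open import Data.Product.Base using (Σ-syntax; ∃; ∃-syntax; ∃₂; _×_; _,_; proj₁; proj₂)
open import Data.Rational.Base as ℚ using (ℚ; 0ℚ; 1ℚ; _/_; ↥_; ↧ₙ_)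
import Data.Rational.Properties as ℚₚ
import Data.Rational.Unnormalised.Base as ℚᵘ
import Data.Rational.Unnormalised.Properties as ℚᵘₚ
open import Data.Vec.Base using (Vec; []; _∷_; lookup; replicate)
open import Function.Base using (_∘_)
open import Function.Bundles using (Inverse)
open import Level using (0ℓ)
import Relation.Binary.Construct.On as On
open import Relation.Binary.PropositionalEquality
  using (_≡_; _≢_; _≗_; _→-setoid_; refl; sym; trans; cong; subst; subst₂)
import Relation.Binary.PropositionalEquality as ≡
open import Relation.Nullary.Negation.Core using (¬_)
open import Relation.Unary using (Pred; _⊆_)
open import Algebra.Definitions.RawSemiring ℚ.+-*-rawSemiring public
  using () renaming (_^_ to _^ℚ_)

------------------------------------------------------------------------
-- Arithmetic of ℚ

ι : ℕ → ℚ
ι n = + n / 1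

infixr 8 _^ℤ_

_^ℤ_ : (k : ℕ) .{{_ : ℕ.NonZero k}} → ℤ → ℚ
k ^ℤ (+ n)    = ι (k ℕ.^ n)
k ^ℤ -[1+ n ] = _/_ (+ 1) (k ℕ.^ suc n) {{ℕₚ.m^n≢0 k (suc n)}}

/-mono : ∀ a b c d .{{_ : ℕ.NonZero b}} .{{_ : ℕ.NonZero d}} →
         a ℤ.* + d ℤ.≤ c ℤ.* + b → a / b ℚ.≤ c / d
/-mono a (suc b) c (suc d) h = ℚₚ.toℚᵘ-cancel-≤
  (ℚᵘₚ.≤-respʳ-≃ (ℚᵘₚ.≃-sym (ℚₚ.toℚᵘ-fromℚᵘ (ℚᵘ.mkℚᵘ c d)))
  (ℚᵘₚ.≤-respˡ-≃ (ℚᵘₚ.≃-sym (ℚₚ.toℚᵘ-fromℚᵘ (ℚᵘ.mkℚᵘ a b))) (ℚᵘ.*≤* h)))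

ι-mono : ∀ {m n} → m ℕ.≤ n → ι m ℚ.≤ ι n
ι-mono {m} {n} h = /-mono (+ m) 1 (+ n) 1
  (subst₂ ℤ._≤_ (sym (ℤₚ.*-identityʳ (+ m))) (sym (ℤₚ.*-identityʳ (+ n))) (ℤ.+≤+ h))

ι-* : ∀ m n → ι m ℚ.* ι n ≡ ι (m ℕ.* n)
ι-* m n = ℚₚ.toℚᵘ-injective (begin-equality
  ℚ.toℚᵘ (ι m ℚ.* ι n)              ≃⟨ ℚₚ.toℚᵘ-homo-* (ι m) (ι n) ⟩
  ℚ.toℚᵘ (ι m) ℚᵘ.* ℚ.toℚᵘ (ι n)    ≃⟨ ℚᵘₚ.*-cong (ℚₚ.toℚᵘ-fromℚᵘ (ℚᵘ.mkℚᵘ (+ m) 0))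
                                                   (ℚₚ.toℚᵘ-fromℚᵘ (ℚᵘ.mkℚᵘ (+ n) 0)) ⟩
  ℚᵘ.mkℚᵘ (+ m ℤ.* + n) 0           ≡⟨ cong (λ z → ℚᵘ.mkℚᵘ z 0) (sym (ℤₚ.pos-* m n)) ⟩
  ℚᵘ.mkℚᵘ (+ (m ℕ.* n)) 0           ≃⟨ ℚₚ.toℚᵘ-fromℚᵘ (ℚᵘ.mkℚᵘ (+ (m ℕ.* n)) 0) ⟨
  ℚ.toℚᵘ (ι (m ℕ.* n))              ∎)
  where open ℚᵘₚ.≤-Reasoning

ι-^ : ∀ m n → ι m ^ℚ n ≡ ι (m ℕ.^ n)
ι-^ m zero    = refl
ι-^ m (suc n) = trans (cong (ι m ℚ.*_) (ι-^ m n)) (ι-* m (m ℕ.^ n))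

0≤ι : ∀ n → 0ℚ ℚ.≤ ι n
0≤ι n = ι-mono {0} {n} z≤n

^ℚ-nonNeg : ∀ {s} → 0ℚ ℚ.≤ s → ∀ n → 0ℚ ℚ.≤ s ^ℚ n
^ℚ-nonNeg 0≤s zero    = 0≤ι 1
^ℚ-nonNeg {s} 0≤s (suc n) = subst (ℚ._≤ s ℚ.* s ^ℚ n) (ℚₚ.*-zeroʳ s)
  (ℚₚ.*-monoˡ-≤-nonNeg s {{ℚ.nonNegative 0≤s}} (^ℚ-nonNeg 0≤s n))

^ℚ-mono : ∀ {s t} → 0ℚ ℚ.≤ s → s ℚ.≤ t → ∀ n → s ^ℚ n ℚ.≤ t ^ℚ n
^ℚ-mono 0≤s s≤t zero    = ℚₚ.≤-refl
^ℚ-mono {s} {t} 0≤s s≤t (suc n) = ℚₚ.≤-trans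
  (ℚₚ.*-monoˡ-≤-nonNeg s {{ℚ.nonNegative 0≤s}} (^ℚ-mono 0≤s s≤t n))
  (ℚₚ.*-monoʳ-≤-nonNeg (t ^ℚ n) {{ℚ.nonNegative (^ℚ-nonNeg (ℚₚ.≤-trans 0≤s s≤t) n)}} s≤t)

^ℚ-pos : ∀ {s} → 0ℚ ℚ.< s → ∀ n → 0ℚ ℚ.< s ^ℚ n
^ℚ-pos 0<s zero    = ℚₚ.positive⁻¹ 1ℚ
^ℚ-pos {s} 0<s (suc n) = subst (ℚ._< s ℚ.* s ^ℚ n) (ℚₚ.*-zeroʳ s)
  (ℚₚ.*-monoʳ-<-pos s {{ℚ.positive 0<s}} (^ℚ-pos 0<s n))

^ℚ-mono-< : ∀ {s t} → 0ℚ ℚ.≤ s → s ℚ.< t → ∀ n → s ^ℚ suc n ℚ.< t ^ℚ suc n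
^ℚ-mono-< {s} {t} 0≤s s<t n = ℚₚ.≤-<-trans
  (ℚₚ.*-monoˡ-≤-nonNeg s {{ℚ.nonNegative 0≤s}} (^ℚ-mono 0≤s (ℚₚ.<⇒≤ s<t) n))
  (ℚₚ.*-monoˡ-<-pos (t ^ℚ n) {{ℚ.positive (^ℚ-pos (ℚₚ.≤-<-trans 0≤s s<t) n)}} s<t)

^ℤ-nonNeg : ∀ k .{{_ : ℕ.NonZero k}} z → 0ℚ ℚ.≤ k ^ℤ z
^ℤ-nonNeg k (+ n)    = 0≤ι (k ℕ.^ n)
^ℤ-nonNeg k -[1+ n ] = ℚₚ.nonNegative⁻¹ _
  {{ℚₚ.normalize-nonNeg 1 (k ℕ.^ suc n) {{ℕₚ.m^n≢0 k (suc n)}}}}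

^ℤ-bound : ∀ k .{{_ : ℕ.NonZero k}} z n → z ℤ.≤ + n → k ^ℤ z ℚ.≤ ι (k ℕ.^ n)
^ℤ-bound k (+ m)    n (ℤ.+≤+ m≤n) = ι-mono (ℕₚ.^-monoʳ-≤ k m≤n)
^ℤ-bound k -[1+ m ] n _ = /-mono (+ 1) (k ℕ.^ suc m) (+ (k ℕ.^ n)) 1 {{ℕₚ.m^n≢0 k (suc m)}} (subst (+ 1 ℤ.≤_)
  (ℤₚ.pos-* (k ℕ.^ n) (k ℕ.^ suc m))
  (ℤ.+≤+ (ℕₚ.*-mono-≤ (ℕₚ.m^n>0 k n) (ℕₚ.m^n>0 k (suc m)))))

≤∣↥∣ : ∀ b → b ℚ.≤ ι (ℤ.∣ ↥ b ∣)
≤∣↥∣ b = subst (ℚ._≤ ι ℤ.∣ ↥ b ∣) (ℚₚ.↥p/↧p≡p b) (/-mono (↥ b) (↧ₙ b) (+ ℤ.∣ ↥ b ∣) 1 (lem (↥ b) (↧ₙ b)))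
  where
  lem : ∀ z d .{{_ : ℕ.NonZero d}} → z ℤ.* + 1 ℤ.≤ + ℤ.∣ z ∣ ℤ.* + d
  lem z d = subst₂ ℤ._≤_ (sym (ℤₚ.*-identityʳ z)) (ℤₚ.pos-* ℤ.∣ z ∣ d)
    (ℤₚ.≤-trans (z≤∣z∣ z) (ℤ.+≤+ (ℕₚ.m≤m*n ℤ.∣ z ∣ d)))
    where
    z≤∣z∣ : ∀ z → z ℤ.≤ + ℤ.∣ z ∣
    z≤∣z∣ (+ n)    = ℤₚ.≤-refl
    z≤∣z∣ -[1+ n ] = ℤ.-≤+

≤ι⇒↥≤ : ∀ r B → r ℚ.≤ ι B → ↥ r ℤ.≤ + (B ℕ.* ↧ₙ r)
≤ι⇒↥≤ r@record{} B h = subst₂ ℤ._≤_ (ℤₚ.*-identityʳ (↥ r)) (sym (ℤₚ.pos-* B (↧ₙ r)))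
  (ℚᵘₚ.drop-*≤* (ℚᵘₚ.≤-respʳ-≃ (ℚₚ.toℚᵘ-fromℚᵘ (ℚᵘ.mkℚᵘ (+ B) 0)) (ℚₚ.toℚᵘ-mono-≤ {r} {ι B} h)))

n<2^n : ∀ n → n ℕ.< 2 ℕ.^ n
n<2^n zero    = s≤s z≤n
n<2^n (suc n) = ℕₚ.≤-trans (ℕₚ.+-mono-≤ (ℕₚ.m^n>0 2 n) (n<2^n n))
  (ℕₚ.≤-reflexive (cong (2 ℕ.^ n ℕ.+_) (sym (ℕₚ.+-identityʳ _))))

------------------------------------------------------------------------
-- Real numbers, as the lower halves of Dedekind cuts. The classical
-- theory of such cuts needs excluded middle.  Since cuts are unique only up
-- to equal lower sets, equality of reals is _≃ᴿ_.

record ℝ : Set₁ where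
  field
    lower     : Pred ℚ 0ℓ
    inhabited : ∃ lower
    bounded   : ∃[ b ] (∀ {q} → lower q → q ℚ.≤ b)
    downward  : ∀ {p q} → p ℚ.≤ q → lower q → lower p
    noMax     : ∀ {p} → lower p → ∃[ q ] p ℚ.< q × lower q

open ℝ public

-- The supremum of a nonempty bounded set of rationals.

sup : (S : Pred ℚ 0ℓ) → ∃ S → ∃[ b ] (∀ {q} → S q → q ℚ.≤ b) → ℝ
sup S (s , Ss) (b , ub) = record
  { lower     = λ q → ∃[ t ] q ℚ.< t × S t
  ; inhabited = s ℚ.- 1ℚ , s , s-1<s , Ss
  ; bounded   = b , λ { (t , q<t , St) → ℚₚ.≤-trans (ℚₚ.<⇒≤ q<t) (ub St) }
  ; downward  = λ { p≤q (t , q<t , St) → t , ℚₚ.≤-<-trans p≤q q<t , St }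
  ; noMax     = λ { (t , q<t , St) →
      let m , q<m , m<t = ℚₚ.<-dense q<t in m , q<m , t , m<t , St }
  }
  where
  s-1<s : s ℚ.- 1ℚ ℚ.< s
  s-1<s = subst (s ℚ.- 1ℚ ℚ.<_) (ℚₚ.+-identityʳ s) (ℚₚ.+-monoʳ-< s (ℚₚ.negative⁻¹ (ℚ.- 1ℚ)))

infix 4 _≤ᴿ_ _<ᴿ_ _≃ᴿ_

_≤ᴿ_ _<ᴿ_ _≃ᴿ_ : ℝ → ℝ → Set
x ≤ᴿ y = lower x ⊆ lower y
x <ᴿ y = ∃[ q ] ¬ lower x q × lower y q
x ≃ᴿ y = x ≤ᴿ y × y ≤ᴿ x

fromℚ : ℚ → ℝ
fromℚ q = sup (_≡ q) (q , refl) (q , λ { refl → ℚₚ.≤-refl })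

fromℕ : ℕ → ℝ
fromℕ n = fromℚ (ι n)

infixl 6 _+ᴿ_

_+ᴿ_ : ℝ → ℝ → ℝ
x +ᴿ y = sup (λ s → ∃₂ λ p q → lower x p × lower y q × s ≡ p ℚ.+ q)
  (_ , _ , _ , proj₂ (inhabited x) , proj₂ (inhabited y) , refl)
  (_ , λ { (_ , _ , xp , yq , refl) → ℚₚ.+-mono-≤ (proj₂ (bounded x) xp) (proj₂ (bounded y) yq) })

scale : (c : ℚ) .{{_ : ℚ.NonNegative c}} → ℝ → ℝ
scale c x = sup (λ s → ∃[ r ] lower x r × s ≡ c ℚ.* r)
  (_ , _ , proj₂ (inhabited x) , refl)
  (_ , λ { (_ , xr , refl) → ℚₚ.*-monoˡ-≤-nonNeg c (proj₂ (bounded x) xr) })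

infixl 7 _*ℕ_ _/ℕ_

_*ℕ_ : ℝ → ℕ → ℝ
x *ℕ m = scale (ι m) {{ℚₚ.normalize-nonNeg m 1}} x

_/ℕ_ : ℝ → (m : ℕ) .{{_ : ℕ.NonZero m}} → ℝ
x /ℕ m = scale (+ 1 / m) {{ℚₚ.normalize-nonNeg 1 m}} x

-- For a ≥ 1:  log k a = sup { p / q : p ≥ 0, q ≥ 1, k ^ p ≤ a ^ q }.

log : (k : ℕ) .{{_ : ℕ.NonTrivial k}} (a : ℕ) .{{_ : ℕ.NonZero a}} → ℝ
log k a = sup (λ r → ∃₂ λ p q → r ≡ + p / suc q × k ℕ.^ p ℕ.≤ a ℕ.^ suc q)
  (_ , 0 , 0 , refl , ℕₚ.m^n>0 a 1)
  (ι a , λ { (p , q , refl , h) → /-mono (+ p) (suc q) (+ a) 1 (subst₂ ℤ._≤_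
      (sym (ℤₚ.*-identityʳ (+ p))) (ℤₚ.pos-* a (suc q)) (ℤ.+≤+ (bound p (suc q) h))) })
  where
  1<k : 1 ℕ.< k
  1<k = ℕ.nonTrivial⇒n>1 k

  a≤k^a : a ℕ.≤ k ℕ.^ a
  a≤k^a = ℕₚ.≤-trans (ℕₚ.<⇒≤ (n<2^n a)) (ℕₚ.^-monoˡ-≤ a 1<k)

  bound : ∀ p q → k ℕ.^ p ℕ.≤ a ℕ.^ q → p ℕ.≤ a ℕ.* q
  bound p q h = ℕₚ.≮⇒≥ λ aq<p → ℕₚ.<⇒≱ (ℕₚ.^-monoʳ-< k 1<k aq<p)
    (ℕₚ.≤-trans h (ℕₚ.≤-trans (ℕₚ.^-monoˡ-≤ q a≤k^a) (ℕₚ.≤-reflexive (ℕₚ.^-*-assoc k a q))))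

-- k ^ᴿ x = sup { s ≥ 0 : s ^ q ≤ k ^ p for some rational p / q < x }.

infixr 8 _^ᴿ_

_^ᴿ_ : (k : ℕ) .{{_ : ℕ.NonZero k}} → ℝ → ℝ
k ^ᴿ x = sup (λ s → 0ℚ ℚ.≤ s × ∃[ r ] lower x r × s ^ℚ ↧ₙ r ℚ.≤ k ^ℤ ↥ r)
  (0ℚ , ℚₚ.≤-refl , r₀ , proj₂ (inhabited x) , 0^q≤ (ℚ.ℚ.denominator-1 r₀))
  (ι (k ℕ.^ B) , λ { {s} (0≤s , r , xr , h) → bound s r xr h })
  where
  r₀ = proj₁ (inhabited x)

  0^q≤ : ∀ d → 0ℚ ^ℚ suc d ℚ.≤ k ^ℤ ↥ r₀
  0^q≤ d = subst (ℚ._≤ k ^ℤ ↥ r₀) (sym (ℚₚ.*-zeroˡ (0ℚ ^ℚ d))) (^ℤ-nonNeg k (↥ r₀))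

  B = ℤ.∣ ↥ proj₁ (bounded x) ∣

  bound : ∀ s r → lower x r → s ^ℚ ↧ₙ r ℚ.≤ k ^ℤ ↥ r → s ℚ.≤ ι (k ℕ.^ B)
  bound s r xr h = ℚₚ.≮⇒≥ λ K<s → ℚₚ.<-irrefl refl (ℚₚ.<-≤-trans
    (^ℚ-mono-< (0≤ι (k ℕ.^ B)) K<s (ℚ.ℚ.denominator-1 r))
    (ℚₚ.≤-trans h (ℚₚ.≤-trans
      (^ℤ-bound k (↥ r) (B ℕ.* ↧ₙ r)
        (≤ι⇒↥≤ r B (ℚₚ.≤-trans (proj₂ (bounded x) xr) (≤∣↥∣ _))))
      (ℚₚ.≤-reflexive (sym (trans (ι-^ (k ℕ.^ B) (↧ₙ r)) (cong ι (ℕₚ.^-*-assoc k B (↧ₙ r)))))))))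

-- The two inequalities say  ∣ u n - l ∣ < ε.

infix 4 _⟶_

_⟶_ : (ℕ → ℝ) → ℝ → Set
u ⟶ l = ∀ ε → 0ℚ ℚ.< ε → ∃[ N ] (∀ n → N ℕ.≤ n →
  u n <ᴿ l +ᴿ fromℚ ε × l <ᴿ u n +ᴿ fromℚ ε)

------------------------------------------------------------------------
-- Hypercubes and hereditary properties of their vertex colourings

Cube : ℕ → Set
Cube = Vec Bool

record OrderEmbedding (m n : ℕ) : Set where
  field
    φ          : Cube m → Cube n
    b          : Fin m → Fin n
    increasing : ∀ {i j} → i Fin.< j → b i Fin.< b j
    active     : ∀ x j → lookup (φ x) (b j) ≡ lookup x j
    fixed      : ∀ x i → (∀ j → b j ≢ i) → lookup (φ x) i ≡ lookup (φ (replicate m false)) i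

Colouring : ℕ → ℕ → Set
Colouring k n = Cube n → Fin k

-- Without function extensionality, invariance under pointwise equality has to
-- be required separately.

record Property (k : ℕ) : Set₁ where
  field
    member   : ∀ n → Pred (Colouring k n) 0ℓ
    respects : ∀ {n} {c d : Colouring k n} → c ≗ d → member n c → member n d

open Property public

OrderHereditary : ∀ {k} → Property k → Set
OrderHereditary {k} P = ∀ {m n} (c : Colouring k n) (e : OrderEmbedding m n) →
  member P n c → member P m (c ∘ OrderEmbedding.φ e)

-- HasSize P n N says ∣ P_n ∣ = N, colourings being counted up to pointwise
-- equality.

HasSize : ∀ {k} → Property k → ℕ → ℕ → Set
HasSize {k} P n N = Inverse
  (On.setoid {B = ∃ (member P n)} (Cube n →-setoid Fin k) proj₁)
  (≡.setoid (Fin N))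

------------------------------------------------------------------------
-- Templates and entropy

record Template (k n : ℕ) : Set where
  field
    palette  : Cube n → Subset k
    nonempty : ∀ x → Subset.Nonempty (palette x)

open Template public

⟨_⟩ : ∀ {k n} → Template k n → Pred (Colouring k n) 0ℓ
⟨ t ⟩ c = ∀ x → c x ∈ palette t x

∑ : ∀ n → (Cube n → ℝ) → ℝ
∑ zero    f = f []
∑ (suc n) f = ∑ n (f ∘ (false ∷_)) +ᴿ ∑ n (f ∘ (true ∷_))

Ent : ∀ {k n} .{{_ : ℕ.NonTrivial k}} → Template k n → ℝ
Ent {k} {n} t = ∑ n λ x → log k ∣ palette t x ∣ {{nonZero x}}
  where
  nonZero : ∀ x → ℕ.NonZero ∣ palette t x ∣
  nonZero x = ℕ.>-nonZero (ℕₚ.≤-<-trans z≤n (x∈p⇒∣p-x∣<∣p∣ (proj₂ (nonempty t x))))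

-- e = ex(Q_n, P), that is, e = max { Ent t : ⟨ t ⟩ ⊆ P_n }

record IsEx {k} .{{_ : ℕ.NonTrivial k}} (P : Property k) (n : ℕ) (e : ℝ) : Set where
  field
    attained   : ∃[ t ] ⟨ t ⟩ ⊆ member P n × Ent t ≃ᴿ e
    upperBound : ∀ t → ⟨ t ⟩ ⊆ member P n → Ent t ≤ᴿ e

-- π is the limit of ex(Q_n, P) / 2 ^ n

IsEntropyDensity : ∀ {k} .{{_ : ℕ.NonTrivial k}} → Property k → ℝ → Set₁
IsEntropyDensity P π = Σ[ ex ∈ (ℕ → ℝ) ] (∀ n → IsEx P n (ex n)) ×
  (λ n → _/ℕ_ (ex n) (2 ℕ.^ n) {{ℕₚ.m^n≢0 2 n}}) ⟶ π

{-# OPTIONS --safe #-}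

-- Write R = 2 ^ r and V = 2 ^ n.  A colouring of Q_(n+r) in P is a V × R matrix whose rows lie in
-- P_r and whose columns lie in P_n, so ∣P_(n+r)∣ ≤ ∣P_n∣ ^ R.  Suppose that every template inside
-- P_r has at most M members.  Reveal the rows one at a time, keeping for every column the number of
-- its continuations in P_n; the product of these R numbers bounds the number of completions.  In
-- each row, call a colour heavy for a column if it preserves a positive proportion of the
-- continuations.  If the heavy colours form a template inside P_r, the row has at most M heavy
-- values and the other values carry little weight; otherwise a heavy row is missing from P_r and the
-- product drops by a constant factor.  Hence either ∣P_(n+r)∣ < (4M) ^ V, or ∣P_(n+r)∣ is smaller
-- than ∣P_n∣ ^ R by a factor exponential in V.  The latter cannot happen for all large n, since the
-- gains would accumulate along n, n + r, n + 2r, ...  This bounds ∣P_n∣ from above by k to the power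
-- (ex(Q_r) / 2 ^ r + small) 2 ^ n; the members of an extremal template give the lower bound.

module Submission where

open import Defs
open import Axiom.ExcludedMiddle using (ExcludedMiddle)
open import Data.Nat.Base hiding (_/_)
open import Data.Product.Base using (Σ; ∃; ∃₂; ∃-syntax; _×_; _,_; proj₁; proj₂)
open import Data.Rational.Base as ℚ using (ℚ; mkℚ; 0ℚ; 1ℚ; _/_; ↥_; ↧ₙ_)
open import Level using (0ℓ)
open import Data.Bool.Base using (Bool; true; false; not; _∧_; if_then_else_)
open import Data.Fin.Base as Fin using (Fin; zero; suc; fromℕ<; combine; remQuot; _↑ˡ_; _↑ʳ_; splitAt)
import Data.Fin.Properties as Finₚ
open import Data.Fin.Subset as Subset using (Subset; ∣_∣; _∈_)
open import Data.Fin.Subset.Properties using (x∈p⇒∣p-x∣<∣p∣)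
open import Data.Integer.Base as ℤ using (+_; -[1+_])
import Data.Integer.Properties as ℤₚ
open import Data.Nat.Coprimality using (1-coprimeTo)
open import Data.Nat.Properties
open import Algebra.Properties.Semiring.Sum +-*-semiring using (sum; ∑-distrib-+; *-distribˡ-sum)
open import Data.Nat.Tactic.RingSolver using (solve-∀)
import Data.Product.Function.Dependent.Propositional as Σ↔
import Data.Rational.Properties as ℚₚ
open import Data.Rational.Solver using (module +-*-Solver)
import Data.Rational.Unnormalised.Base as ℚᵘ
import Data.Rational.Unnormalised.Properties as ℚᵘₚ
open import Data.Sum.Base using (_⊎_; inj₁; inj₂)
open import Data.Sum.Function.Propositional using (_⊎-↔_)
open import Data.Vec.Base as Vec using (Vec; []; _∷_; lookup; tabulate; _++_; take; drop; replicate)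
open import Data.Vec.Functional using (foldr)
import Data.Vec.Properties as Vecₚ
open import Function.Base using (_∘_; const)
open import Function.Bundles using (_↔_; mk↔ₛ′; module Inverse)
open import Function.Construct.Composition using (_↔-∘_)
open import Function.Construct.Identity using (↔-id)
open import Function.Definitions using (Injective)
open import Relation.Binary.PropositionalEquality
open import Relation.Nullary.Decidable using (Dec; does; yes; no; dec-true; decidable-stable)
open import Relation.Nullary.Negation using (¬_; contradiction)
open import Relation.Unary using (_⊆_)

open +-*-Solver using (solve; _:=_; _:+_; _:*_; _:-_)

-- Finite sums

-- Which colours are heavy depends on the rows already revealed, so the heavy box changes from row
-- to row and no single template contains the whole matrix. What survives is a pair of inequalities
-- valid for every row (`step`): one controls the number of choices, the other the weight, and
-- `count-bound` merely multiplies them up. The factor 4 in `(4M) ^ V` is harmless because the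
-- matrix has `V * R` entries: it adds only log 4 / R to the exponent per vertex, which vanishes as
-- `r` grows. In the other alternative the gain is exponential in `V`, with a rate depending on `R`
-- but not on `V`. It therefore lowers log ∣P_n∣ / 2 ^ n by a fixed amount whenever `n` grows by
-- `r`, whereas this quantity never becomes negative, as P_n is nonempty. Counting is done in ℕ with
-- denominators cleared: a ratio such as 1 + 1 / W₀ appears as the pair `W₁`, `W₀`, and a rational
-- exponent p / d as a `d`-th power on one side and `k ^ p` on the other.

record Summation (A : Set) : Set where
  field
    sumOver : (A → ℕ) → ℕ
    ∑-mono  : ∀ {f g} → (∀ a → f a ≤ g a) → sumOver f ≤ sumOver g
    ∑-+     : ∀ f g → sumOver (λ a → f a + g a) ≡ sumOver f + sumOver g
    ∑-*     : ∀ c f → sumOver (λ a → c * f a) ≡ c * sumOver f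
    -- This makes a sum the cardinality of a disjoint union, so that injections become inequalities
    -- between sums.
    ∑-↔     : ∀ f → Fin (sumOver f) ↔ Σ A (Fin ∘ f)

  ∑-cong : ∀ {f g} → (∀ a → f a ≡ g a) → sumOver f ≡ sumOver g
  ∑-cong f≗g = ≤-antisym (∑-mono (≤-reflexive ∘ f≗g)) (∑-mono (≤-reflexive ∘ sym ∘ f≗g))

  injection⇒≤∑ : ∀ {m} f (ρ : Fin m → A) → Injective _≡_ _≡_ ρ →
                 (∀ i → 1 ≤ f (ρ i)) → m ≤ sumOver f
  injection⇒≤∑ f ρ inj pos = Finₚ.injective⇒≤ {f = λ i → from (ρ i , fromℕ< (pos i))} λ {i} {j} e →
    inj (cong proj₁ (trans (sym (inv (ρ i , _))) (trans (cong to e) (inv (ρ j , _)))))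
    where
    open Inverse (∑-↔ f) using (to; from)
    inv = Inverse.strictlyInverseˡ (∑-↔ f)

  term≤∑ : ∀ f a → f a ≤ sumOver f
  term≤∑ f a = Finₚ.injective⇒≤ {f = λ i → Inverse.from (∑-↔ f) (a , i)} λ {i} {j} e →
    lem (trans (sym (inv (a , i))) (trans (cong (Inverse.to (∑-↔ f)) e) (inv (a , j))))
    where
    inv = Inverse.strictlyInverseˡ (∑-↔ f)
    lem : ∀ {i j} → _≡_ {A = Σ A (Fin ∘ f)} (a , i) (a , j) → i ≡ j
    lem refl = refl

  -- The second argument of `φ`, an element of `Fin (f a)`, is evidence that `f a` is nonzero: the
  -- intended maps exist only on the support of `f`.
  ∑≤injection : ∀ {m} f → (∀ a → f a ≤ 1) → (φ : ∀ a → Fin (f a) → Fin m) →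
                (∀ {a b x y} → φ a x ≡ φ b y → a ≡ b) → sumOver f ≤ m
  ∑≤injection f f≤1 φ inj = Finₚ.injective⇒≤ {f = λ i → φ (proj₁ (to i)) (proj₂ (to i))} λ {i} {j} e →
    trans (sym (Inverse.strictlyInverseʳ (∑-↔ f) i))
      (trans (cong from (pair (to i) (to j) (inj e))) (Inverse.strictlyInverseʳ (∑-↔ f) j))
    where
    open Inverse (∑-↔ f) using (to; from)
    unique : ∀ {n} → n ≤ 1 → (x y : Fin n) → x ≡ y
    unique (s≤s z≤n) zero zero = refl
    pair : (p q : Σ A (Fin ∘ f)) → proj₁ p ≡ proj₁ q → p ≡ q
    pair (a , x) (.a , y) refl = cong (a ,_) (unique (f≤1 a) x y)

  ∑≡0⊎∃ : ∀ f → (∀ a → f a ≡ 0) ⊎ ∃[ a ] Fin (f a)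
  ∑≡0⊎∃ f with sumOver f in eq
  ... | zero  = inj₁ λ a → n≤0⇒n≡0 (≤-trans (term≤∑ f a) (≤-reflexive eq))
  ... | suc n = inj₂ (Inverse.to (∑-↔ f) (subst Fin (sym eq) zero))

open Summation

sum-mono : ∀ {n} {f g : Fin n → ℕ} → (∀ i → f i ≤ g i) → sum f ≤ sum g
sum-mono {zero}  f≤g = z≤n
sum-mono {suc n} f≤g = +-mono-≤ (f≤g zero) (sum-mono (f≤g ∘ suc))

sum-↔ : ∀ {n} (f : Fin n → ℕ) → Fin (sum f) ↔ Σ (Fin n) (Fin ∘ f)
sum-↔ {zero}  f = mk↔ₛ′ (λ ()) (λ ()) (λ ()) (λ ())
sum-↔ {suc n} f = split ↔-∘ ((↔-id _ ⊎-↔ sum-↔ (f ∘ suc)) ↔-∘ Finₚ.+↔⊎)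
  where
  split : (Fin (f zero) ⊎ Σ (Fin n) (Fin ∘ f ∘ suc)) ↔ Σ (Fin (suc n)) (Fin ∘ f)
  split = mk↔ₛ′
    (λ { (inj₁ x) → zero , x ; (inj₂ (i , x)) → suc i , x })
    (λ { (zero , x) → inj₁ x ; (suc i , x) → inj₂ (i , x) })
    (λ { (zero , x) → refl ; (suc i , x) → refl })
    (λ { (inj₁ x) → refl ; (inj₂ (i , x)) → refl })

finSummation : ∀ n → Summation (Fin n)
finSummation n = record
  { sumOver = sum ; ∑-mono = sum-mono ; ∑-+ = ∑-distrib-+
  ; ∑-* = λ c f → sym (*-distribˡ-sum c f) ; ∑-↔ = sum-↔ }

vecSummation : ∀ {A} → Summation A → ∀ n → Summation (Vec A n)
vecSummation {A} Σᴬ zero = record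
  { sumOver = λ f → f [] ; ∑-mono = λ f≤g → f≤g [] ; ∑-+ = λ _ _ → refl ; ∑-* = λ _ _ → refl
  ; ∑-↔ = λ f → mk↔ₛ′ ([] ,_) (λ { ([] , x) → x }) (λ { ([] , x) → refl }) (λ _ → refl) }
vecSummation {A} Σᴬ (suc n) = record
  { sumOver      = λ f → sumOver Σᴬ λ a → sumOver Σⱽ (f ∘ (a ∷_))
  ; ∑-mono = λ f≤g → ∑-mono Σᴬ λ a → ∑-mono Σⱽ λ v → f≤g (a ∷ v)
  ; ∑-+    = λ f g → trans (∑-cong Σᴬ λ a → ∑-+ Σⱽ _ _) (∑-+ Σᴬ _ _)
  ; ∑-*    = λ c f → trans (∑-cong Σᴬ λ a → ∑-* Σⱽ c _) (∑-* Σᴬ c _)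
  ; ∑-↔    = λ f → cons f ↔-∘ (Σ↔.congˡ (λ {a} → ∑-↔ Σⱽ (f ∘ (a ∷_))) ↔-∘ ∑-↔ Σᴬ _)
  }
  where
  Σⱽ = vecSummation Σᴬ n
  cons : ∀ f → Σ A (λ a → Σ (Vec A n) (Fin ∘ f ∘ (a ∷_))) ↔ Σ (Vec A (suc n)) (Fin ∘ f)
  cons f = mk↔ₛ′ (λ (a , v , x) → a ∷ v , x) (λ { (a ∷ v , x) → a , v , x })
    (λ { (a ∷ v , x) → refl }) (λ { (a , v , x) → refl })

∏ : ∀ {n} → (Fin n → ℕ) → ℕ
∏ = foldr _*_ 1

∏-mono : ∀ {n} {f g : Fin n → ℕ} → (∀ i → f i ≤ g i) → ∏ f ≤ ∏ g
∏-mono {zero}  f≤g = ≤-refl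
∏-mono {suc n} f≤g = *-mono-≤ (f≤g zero) (∏-mono (f≤g ∘ suc))

∏-const : ∀ n c → ∏ {n} (const c) ≡ c ^ n
∏-const zero    c = refl
∏-const (suc n) c = cong (c *_) (∏-const n c)

sum-const : ∀ n c → sum {n} (const c) ≡ n * c
sum-const zero    c = refl
sum-const (suc n) c = cong (λ e → c + e) (sum-const n c)

does-true : ∀ {P : Set} (P? : Dec P) → does P? ≡ true → P
does-true (yes p) _ = p

does-false : ∀ {P : Set} (P? : Dec P) → does P? ≡ false → ¬ P
does-false (no ¬p) _ = ¬p

⟦_⟧ : Bool → ℕ
⟦ true ⟧  = 1
⟦ false ⟧ = 0

⟦⟧≤1 : ∀ b → ⟦ b ⟧ ≤ 1
⟦⟧≤1 true  = ≤-refl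
⟦⟧≤1 false = z≤n

-- Words over the colours: product weights and boxes

module _ {k : ℕ} where

  words : ∀ R → Summation (Vec (Fin k) R)
  words = vecSummation (finSummation k)

  -- An unnormalised product measure on words, of total mass `volume g`. In the application `g y i`
  -- counts the continuations of column `y` after the colour `i`.
  weight : ∀ {R} → (Fin R → Fin k → ℕ) → Vec (Fin k) R → ℕ
  weight g []      = 1
  weight g (i ∷ s) = g zero i * weight (g ∘ suc) s

  volume : ∀ {R} → (Fin R → Fin k → ℕ) → ℕ
  volume g = ∏ λ y → sum (g y)

  box : ∀ {R} → (Fin R → Fin k → Bool) → Vec (Fin k) R → Bool
  box T []      = true
  box T (i ∷ s) = T zero i ∧ box (T ∘ suc) s

  ∑-weight : ∀ R (g : Fin R → Fin k → ℕ) → sumOver (words R) (weight g) ≡ volume g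
  ∑-weight zero    g = refl
  ∑-weight (suc R) g = begin
    (sum λ i → sumOver (words R) λ s → g zero i * weight (g ∘ suc) s)
      ≡⟨ ∑-cong (finSummation k) (λ i → trans (∑-* (words R) (g zero i) (weight (g ∘ suc)))
           (trans (cong (g zero i *_) (∑-weight R (g ∘ suc))) (*-comm (g zero i) _))) ⟩
    (sum λ i → volume (g ∘ suc) * g zero i)
      ≡⟨ ∑-* (finSummation k) (volume (g ∘ suc)) (g zero) ⟩
    volume (g ∘ suc) * sum (g zero)
      ≡⟨ *-comm (volume (g ∘ suc)) _ ⟩
    volume g ∎
    where open ≡-Reasoning

  ∑-1 : ∀ R → sumOver (words R) (const 1) ≡ k ^ R
  ∑-1 R = begin
    sumOver (words R) (const 1)      ≡⟨ ∑-cong (words R) weight-1 ⟨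
    sumOver (words R) (weight λ _ _ → 1) ≡⟨ ∑-weight R (λ _ _ → 1) ⟩
    (∏ {R} λ _ → sum {k} (const 1))  ≡⟨ ∏-const R _ ⟩
    sum {k} (const 1) ^ R      ≡⟨ cong (_^ R) (trans (sum-const k 1) (*-identityʳ k)) ⟩
    k ^ R                      ∎
    where
    open ≡-Reasoning
    weight-1 : ∀ {R} (s : Vec (Fin k) R) → weight (λ _ _ → 1) s ≡ 1
    weight-1 []      = refl
    weight-1 (i ∷ s) = trans (+-identityʳ _) (weight-1 s)

  box-weight : ∀ {R} (T : Fin R → Fin k → Bool) s → weight (λ y i → ⟦ T y i ⟧) s ≡ ⟦ box T s ⟧
  box-weight T [] = refl
  box-weight T (i ∷ s) with T zero i
  ... | true  = trans (+-identityʳ _) (box-weight (T ∘ suc) s)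
  ... | false = refl

  ∑-box : ∀ R (T : Fin R → Fin k → Bool) →
          sumOver (words R) (λ s → ⟦ box T s ⟧) ≡ ∏ λ y → sum λ i → ⟦ T y i ⟧
  ∑-box R T = trans (∑-cong (words R) (sym ∘ box-weight T)) (∑-weight R _)

  box⇒ : ∀ {R} (T : Fin R → Fin k → Bool) s → box T s ≡ true → ∀ y → T y (lookup s y) ≡ true
  box⇒ T (i ∷ s) h y with T zero i in eq
  box⇒ T (i ∷ s) h zero    | true = eq
  box⇒ T (i ∷ s) h (suc y) | true = box⇒ (T ∘ suc) s h y

  ⇒box : ∀ {R} (T : Fin R → Fin k → Bool) s → (∀ y → T y (lookup s y) ≡ true) → box T s ≡ true
  ⇒box T []      h = refl
  ⇒box T (i ∷ s) h rewrite h zero = ⇒box (T ∘ suc) s (h ∘ suc)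

  weight-of-heavy : ∀ {R} c (g : Fin R → Fin k → ℕ) s →
    (∀ y → sum (g y) ≤ c * g y (lookup s y)) → volume g ≤ c ^ R * weight g s
  weight-of-heavy c g [] h = ≤-refl
  weight-of-heavy {suc R} c g (i ∷ s) h = begin
    sum (g zero) * volume (g ∘ suc)              ≤⟨ *-mono-≤ (h zero) (weight-of-heavy c (g ∘ suc) s (h ∘ suc)) ⟩
    (c * g zero i) * (c ^ R * weight (g ∘ suc) s) ≡⟨ lem c (g zero i) (c ^ R) _ ⟩
    c ^ suc R * weight g (i ∷ s)                 ∎
    where
    open ≤-Reasoning
    lem : ∀ a b c d → (a * b) * (c * d) ≡ (a * c) * (b * d)
    lem = solve-∀

  -- A union bound: a word outside the box has a light colour `i` at some position `y`, and each of
  -- the at most `R * k` pairs accounts for at most 1 / c of the volume.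
  weight-of-light : ∀ {R} c (g : Fin R → Fin k → ℕ) (T : Fin R → Fin k → Bool) →
    (∀ y i → T y i ≡ false → c * g y i ≤ sum (g y)) →
    c * sumOver (words R) (λ s → ⟦ not (box T s) ⟧ * weight g s) ≤ R * k * volume g
  weight-of-light {zero}  c g T h = ≤-reflexive (*-zeroʳ c)
  weight-of-light {suc R} c g T h = begin
    c * sum (λ i → outer i)
      ≡⟨ ∑-* (finSummation k) c outer ⟨
    sum (λ i → c * outer i)
      ≤⟨ sum-mono bound ⟩
    sum (λ i → G₀ * vol + R * k * vol * g zero i)
      ≡⟨ ∑-+ (finSummation k) (const (G₀ * vol)) (λ i → R * k * vol * g zero i) ⟩
    sum {k} (const (G₀ * vol)) + sum (λ i → R * k * vol * g zero i)
      ≡⟨ cong₂ _+_ (sum-const k _) (∑-* (finSummation k) (R * k * vol) (g zero)) ⟩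
    k * (G₀ * vol) + R * k * vol * G₀
      ≡⟨ lem k G₀ vol R ⟩
    suc R * k * (G₀ * vol) ∎
    where
    open ≤-Reasoning
    G₀  = sum (g zero)
    vol = volume (g ∘ suc)
    T′  = T ∘ suc
    outer : Fin k → ℕ
    outer i = sumOver (words R) λ s → ⟦ not (T zero i ∧ box T′ s) ⟧ * (g zero i * weight (g ∘ suc) s)

    lem : ∀ k G v R → k * (G * v) + R * k * v * G ≡ (1 + R) * k * (G * v)
    lem = solve-∀
    lem₁ : ∀ c a b → c * (a * b) ≡ c * b * a
    lem₁ = solve-∀
    lem₂ : ∀ a b c → a * (b * c) ≡ b * (a * c)
    lem₂ = solve-∀

    bound : ∀ i → c * outer i ≤ G₀ * vol + R * k * vol * g zero i
    bound i with T zero i in eq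
    -- A light first colour: all words starting with it are charged to this position, whatever
    -- follows. After a heavy one the light colour must occur later, which is the induction
    -- hypothesis.
    ... | false = ≤-trans (begin
      c * (sumOver (words R) λ s → 1 * (g zero i * weight (g ∘ suc) s))
        ≡⟨ cong (c *_) (∑-* (words R) 1 _) ⟩
      c * (1 * (sumOver (words R) λ s → g zero i * weight (g ∘ suc) s))
        ≡⟨ cong (c *_) (trans (+-identityʳ _) (trans (∑-* (words R) (g zero i) (weight (g ∘ suc)))
             (cong (g zero i *_) (∑-weight R (g ∘ suc))))) ⟩
      c * (g zero i * vol)
        ≡⟨ *-assoc c (g zero i) vol ⟨
      c * g zero i * vol
        ≤⟨ *-monoˡ-≤ vol (h zero i eq) ⟩
      G₀ * vol ∎) (m≤m+n _ _)
    ... | true = ≤-trans (begin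
      c * (sumOver (words R) λ s → ⟦ not (box T′ s) ⟧ * (g zero i * weight (g ∘ suc) s))
        ≡⟨ cong (c *_) (trans (∑-cong (words R) λ s → lem₂ ⟦ not (box T′ s) ⟧ (g zero i) _)
             (∑-* (words R) (g zero i) (λ s → ⟦ not (box T′ s) ⟧ * weight (g ∘ suc) s))) ⟩
      c * (g zero i * (sumOver (words R) λ s → ⟦ not (box T′ s) ⟧ * weight (g ∘ suc) s))
        ≡⟨ lem₁ c (g zero i) _ ⟩
      c * (sumOver (words R) λ s → ⟦ not (box T′ s) ⟧ * weight (g ∘ suc) s) * g zero i
        ≤⟨ *-monoˡ-≤ (g zero i) (weight-of-light c (g ∘ suc) T′ (h ∘ suc)) ⟩
      R * k * vol * g zero i ∎) (m≤n+m _ _)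

  -- Matrices with rows in `S` and weighted columns

  module Matrices {R} (S : Vec (Fin k) R → Bool) where

    ∑-S : ∀ g → sumOver (words R) (λ s → ⟦ S s ⟧ * weight g s) ≤ volume g
    ∑-S g = ≤-trans (∑-mono (words R) λ s → ≤-trans (*-monoˡ-≤ (weight g s) (⟦⟧≤1 (S s))) (≤-reflexive (+-identityʳ _)))
      (≤-reflexive (∑-weight R g))

    matrices : ∀ V → Summation (Vec (Vec (Fin k) R) V)
    matrices = vecSummation (words R)

    slice : ∀ {V} → (Fin R → Vec (Fin k) (suc V) → ℕ) → Vec (Fin k) R → Fin R → Vec (Fin k) V → ℕ
    slice G s y v = G y (lookup s y ∷ v)

    -- Slicing feeds the entries of each column to `G` one by one, so the final `G y []` is the
    -- weight of the whole column `y`. For 0/1-valued `G` this is the indicator of the matrices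
    -- whose rows and columns are all admissible.
    fits : ∀ {V} → (Fin R → Vec (Fin k) V → ℕ) → Vec (Vec (Fin k) R) V → ℕ
    fits G []         = ∏ λ y → G y []
    fits G (s ∷ rows) = ⟦ S s ⟧ * fits (slice G s) rows

    count : ∀ V → (Fin R → Vec (Fin k) V → ℕ) → ℕ
    count V G = sumOver (matrices V) (fits G)

    -- The total weight once the condition on the rows is dropped: the columns are then independent.
    capacity : ∀ V → (Fin R → Vec (Fin k) V → ℕ) → ℕ
    capacity V G = ∏ λ y → sumOver (words V) (G y)

    count-suc : ∀ V G → count (suc V) G ≡ sumOver (words R) λ s → ⟦ S s ⟧ * count V (slice G s)
    count-suc V G = ∑-cong (words R) λ s → ∑-* (matrices V) ⟦ S s ⟧ (fits (slice G s))

    capacity-slice : ∀ {R} (g : Fin R → Fin k → ℕ) s → (∏ λ y → g y (lookup s y)) ≡ weight g s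
    capacity-slice g []      = refl
    capacity-slice g (i ∷ s) = cong (g zero i *_) (capacity-slice (g ∘ suc) s)

    count≤capacity : ∀ V G → count V G ≤ capacity V G
    count≤capacity zero    G = ≤-refl
    count≤capacity (suc V) G = begin
      count (suc V) G                                      ≡⟨ count-suc V G ⟩
      sumOver (words R) (λ s → ⟦ S s ⟧ * count V (slice G s))    ≤⟨ ∑-mono (words R) (λ s → *-monoʳ-≤ ⟦ S s ⟧ (count≤capacity V (slice G s))) ⟩
      sumOver (words R) (λ s → ⟦ S s ⟧ * capacity V (slice G s)) ≡⟨ ∑-cong (words R) (λ s → cong (⟦ S s ⟧ *_) (capacity-slice g s)) ⟩
      sumOver (words R) (λ s → ⟦ S s ⟧ * weight g s)             ≤⟨ ∑-S g ⟩
      capacity (suc V) G                                   ∎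
      where
      open ≤-Reasoning
      g : Fin R → Fin k → ℕ
      g y i = sumOver (words V) (λ v → G y (i ∷ v))

    fits-pos : ∀ {V} G (rows : Vec (Vec (Fin k) R) V) → (∀ x → S (lookup rows x) ≡ true) →
      (∀ y → 1 ≤ G y (Vec.map (λ s → lookup s y) rows)) → 1 ≤ fits G rows
    fits-pos G []         h₁ h₂ = ≤-trans (≤-reflexive (sym (trans (∏-const R 1) (^-zeroˡ R)))) (∏-mono h₂)
    fits-pos G (s ∷ rows) h₁ h₂ rewrite h₁ zero =
      ≤-trans (fits-pos (slice G s) rows (h₁ ∘ suc) h₂) (≤-reflexive (sym (+-identityʳ _)))

  -- Revealing the rows one at a time

  module Counting {R} (S : Vec (Fin k) R → Bool) (M : ℕ)
    (M-bound : ∀ T → (∀ s → box T s ≡ true → S s ≡ true) → (∏ λ y → sum λ i → ⟦ T y i ⟧) ≤ M)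
    (X : ℕ) .{{_ : NonZero (R * k)}} where

    open Matrices S

    -- A colour is heavy if its share is at least 1 / c, so a heavy word has at least 1 / W₀ of the
    -- volume.  X makes the loss K₁ / K₀ of an ordinary row small compared with the gain W₁ / W₀.
    c Z W₀ W₁ K₀ K₁ : ℕ
    c  = R * k * X
    Z  = k ^ R
    W₀ = c ^ R
    W₁ = suc W₀
    K₀ = W₀ * X
    K₁ = suc K₀

    module _ (g : Fin R → Fin k → ℕ) where

      heavy : Fin R → Fin k → Bool
      heavy y i = does (sum (g y) ≤? c * g y i)

      heavy⇒ : ∀ {y i} → heavy y i ≡ true → sum (g y) ≤ c * g y i
      heavy⇒ {y} {i} = does-true (sum (g y) ≤? c * g y i)

      light⇒ : ∀ y i → heavy y i ≡ false → c * g y i ≤ sum (g y)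
      light⇒ y i h = <⇒≤ (≰⇒> (does-false (sum (g y) ≤? c * g y i) h))

      -- Either some heavy word is missing from S, which makes the total weight of S drop
      -- by a constant factor, or the heavy words form a box inside S, so that there are
      -- at most M of them, and the others have small total weight.
      step : ∃[ marked ]
        sumOver (words R) (λ s → ⟦ S s ⟧ * (if marked s then 1 else Z)) ≤ Z * suc M ×
        K₀ * sumOver (words R) (λ s → ⟦ S s ⟧ * (weight g s * (if marked s then W₁ else W₀)))
          ≤ W₀ * K₁ * volume g
      step with ∑≡0⊎∃ (words R) (λ s → ⟦ box heavy s ∧ not (S s) ⟧)
      -- A heavy word `s` is missing from `S`. Marking every word keeps the first inequality, as
      -- there are only `Z` words, and the loss of `s` lets all of them claim the gain.
      ... | inj₂ (s , x) = (λ _ → true) ,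
        (begin
          sumOver (words R) (λ s → ⟦ S s ⟧ * 1) ≤⟨ ∑-mono (words R) (λ s → ≤-trans (≤-reflexive (*-identityʳ _)) (⟦⟧≤1 (S s))) ⟩
          sumOver (words R) (const 1) ≡⟨ ∑-1 R ⟩
          Z ≤⟨ m≤m*n Z (suc M) ⟩
          Z * suc M ∎) ,
        (begin
          K₀ * sumOver (words R) (λ s → ⟦ S s ⟧ * (weight g s * W₁))
            ≡⟨ cong (K₀ *_) (trans (∑-cong (words R) λ s → lem₁ ⟦ S s ⟧ (weight g s) W₁)
                 (∑-* (words R) W₁ _)) ⟩
          K₀ * (W₁ * A)                  ≤⟨ *-monoʳ-≤ K₀ loss ⟩
          K₀ * (W₀ * volume g)           ≡⟨ lem₂ K₀ W₀ (volume g) ⟩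
          W₀ * K₀ * volume g             ≤⟨ *-monoˡ-≤ (volume g) (*-monoʳ-≤ W₀ (n≤1+n K₀)) ⟩
          W₀ * K₁ * volume g             ∎)
        where
        open ≤-Reasoning
        A = sumOver (words R) (λ s → ⟦ S s ⟧ * weight g s)
        lem₁ : ∀ a b c → a * (b * c) ≡ c * (a * b)
        lem₁ = solve-∀
        lem₂ : ∀ a b c → a * (b * c) ≡ b * a * c
        lem₂ = solve-∀
        lem₃ : ∀ W A v → W * A + W * v ≡ W * (A + v)
        lem₃ = solve-∀
        cases : ∀ a b → Fin ⟦ a ∧ not b ⟧ → a ≡ true × not b ≡ true
        cases true false x = refl , refl
        s-heavy = proj₁ (cases (box heavy s) (S s) x)
        s∉S : not (S s) ≡ true
        s∉S = proj₂ (cases (box heavy s) (S s) x)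
        split : ∀ b w → ⟦ b ⟧ * w + ⟦ not b ⟧ * w ≡ w
        split true  w = trans (+-identityʳ _) (+-identityʳ w)
        split false w = +-identityʳ w

        A+ws≤vol : A + weight g s ≤ volume g
        A+ws≤vol = begin
          A + weight g s
            ≡⟨ cong (λ e → A + e) (trans (sym (+-identityʳ (weight g s))) (cong (λ b → ⟦ b ⟧ * weight g s) (sym s∉S))) ⟩
          A + ⟦ not (S s) ⟧ * weight g s
            ≤⟨ +-monoʳ-≤ A (term≤∑ (words R) (λ s → ⟦ not (S s) ⟧ * weight g s) s) ⟩
          A + sumOver (words R) (λ s → ⟦ not (S s) ⟧ * weight g s)
            ≡⟨ ∑-+ (words R) _ _ ⟨
          sumOver (words R) (λ s → ⟦ S s ⟧ * weight g s + ⟦ not (S s) ⟧ * weight g s)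
            ≡⟨ ∑-cong (words R) (λ s → split (S s) (weight g s)) ⟩
          sumOver (words R) (weight g)
            ≡⟨ ∑-weight R g ⟩
          volume g ∎

        -- The extra copy of `A` in `W₁ * A` is at most the volume, hence at most `W₀` times the
        -- weight of the missing word.
        loss : W₁ * A ≤ W₀ * volume g
        loss = begin
          A + W₀ * A               ≤⟨ +-monoˡ-≤ (W₀ * A) (∑-S g) ⟩
          volume g + W₀ * A        ≤⟨ +-monoˡ-≤ (W₀ * A) (weight-of-heavy c g s λ y → heavy⇒ (box⇒ heavy s s-heavy y)) ⟩
          W₀ * weight g s + W₀ * A ≡⟨ trans (+-comm (W₀ * weight g s) _) (lem₃ W₀ A (weight g s)) ⟩
          W₀ * (A + weight g s)    ≤⟨ *-monoʳ-≤ W₀ A+ws≤vol ⟩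
          W₀ * volume g            ∎
      -- No heavy word is missing. Marked are the words with a light colour: at most `Z` of them,
      -- with at most 1 / X of the volume. The unmarked ones form the box to which `M-bound`
      -- applies.
      ... | inj₁ none = (λ s → not (box heavy s)) ,
        (begin
          sumOver (words R) (λ s → ⟦ S s ⟧ * (if not (box heavy s) then 1 else Z))
            ≤⟨ ∑-mono (words R) (λ s → bound₁ (S s) (box heavy s)) ⟩
          sumOver (words R) (λ s → 1 + Z * ⟦ box heavy s ⟧)
            ≡⟨ trans (∑-+ (words R) _ _) (cong₂ _+_ (∑-1 R) (∑-* (words R) Z _)) ⟩
          Z + Z * sumOver (words R) (λ s → ⟦ box heavy s ⟧)
            ≤⟨ +-monoʳ-≤ Z (*-monoʳ-≤ Z (≤-trans (≤-reflexive (∑-box R heavy))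
                 (M-bound heavy λ s h → cases (S s) (subst (λ b → ⟦ b ∧ not (S s) ⟧ ≡ 0) h (none s))))) ⟩
          Z + Z * M
            ≡⟨ *-suc Z M ⟨
          Z * suc M ∎) ,
        (begin
          K₀ * sumOver (words R) (λ s → ⟦ S s ⟧ * (weight g s * (if not (box heavy s) then W₁ else W₀)))
            ≤⟨ *-monoʳ-≤ K₀ (∑-mono (words R) λ s → bound₂ (S s) (box heavy s) (weight g s)) ⟩
          K₀ * sumOver (words R) (λ s → W₀ * weight g s + ⟦ not (box heavy s) ⟧ * weight g s)
            ≡⟨ cong (K₀ *_) (trans (∑-+ (words R) _ _) (cong (_+ B)
                 (trans (∑-* (words R) W₀ _) (cong (W₀ *_) (∑-weight R g))))) ⟩
          K₀ * (W₀ * volume g + B)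
            ≡⟨ lem₁ W₀ X (volume g) B ⟩
          W₀ * (K₀ * volume g + X * B)
            ≤⟨ *-monoʳ-≤ W₀ (+-monoʳ-≤ (K₀ * volume g) X*B≤vol) ⟩
          W₀ * (K₀ * volume g + volume g)
            ≡⟨ lem₂ W₀ K₀ (volume g) ⟩
          W₀ * K₁ * volume g ∎)
        where
        open ≤-Reasoning
        B = sumOver (words R) (λ s → ⟦ not (box heavy s) ⟧ * weight g s)
        cases : ∀ b → ⟦ not b ⟧ ≡ 0 → b ≡ true
        cases true _ = refl
        lem₁ : ∀ W X v B → W * X * (W * v + B) ≡ W * (W * X * v + X * B)
        lem₁ = solve-∀
        lem₂ : ∀ W K v → W * (K * v + v) ≡ W * (1 + K) * v
        lem₂ = solve-∀
        lem₃ : ∀ r X B → r * X * B ≡ r * (X * B)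
        lem₃ = solve-∀
        bound₁ : ∀ a b → ⟦ a ⟧ * (if not b then 1 else Z) ≤ 1 + Z * ⟦ b ⟧
        bound₁ false b     = z≤n
        bound₁ true  true  = ≤-trans (≤-reflexive (trans (+-identityʳ Z) (sym (*-identityʳ Z)))) (n≤1+n _)
        bound₁ true  false = s≤s z≤n
        bound₂ : ∀ a b w → ⟦ a ⟧ * (w * (if not b then W₁ else W₀)) ≤ W₀ * w + ⟦ not b ⟧ * w
        bound₂ false b     w = z≤n
        bound₂ true  true  w = ≤-reflexive (trans (+-identityʳ _) (trans (*-comm w W₀) (sym (+-identityʳ _))))
        bound₂ true  false w = ≤-reflexive (lem w W₀)
          where
          lem : ∀ w W → w * (1 + W) + 0 ≡ W * w + (w + 0)
          lem = solve-∀
        X*B≤vol : X * B ≤ volume g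
        X*B≤vol = *-cancelˡ-≤ (R * k) (begin
          R * k * (X * B)     ≡⟨ lem₃ (R * k) X B ⟨
          c * B               ≤⟨ weight-of-light c g heavy light⇒ ⟩
          R * k * volume g    ∎)

    -- Divided by W₁ ^ j * K₀ ^ V, the first term bounds the number of matrices with at most j marked
    -- rows; in the others every marked row gains the factor W₀ / W₁ in the bound by the capacity.
    count-bound : ∀ V j G → (∀ y v → G y v ≤ 1) →
      count V G * (W₁ ^ j * K₀ ^ V) ≤
        W₁ ^ j * (Z ^ j * suc M ^ V * K₀ ^ V) + W₀ ^ j * (K₁ ^ V * capacity V G)
    count-bound V zero G G≤1 = begin
      count V G * (1 * K₀ ^ V)     ≤⟨ *-mono-≤ (count≤capacity V G) (≤-trans (≤-reflexive (+-identityʳ (K₀ ^ V))) (^-monoˡ-≤ V (n≤1+n K₀))) ⟩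
      capacity V G * K₁ ^ V        ≡⟨ trans (*-comm (capacity V G) _) (sym (+-identityʳ _)) ⟩
      1 * (K₁ ^ V * capacity V G)  ≤⟨ m≤n+m _ (1 * (1 * suc M ^ V * K₀ ^ V)) ⟩
      _                            ∎
      where open ≤-Reasoning
    count-bound zero j@(suc _) G G≤1 = begin
      count 0 G * (W₁ ^ j * 1)  ≤⟨ *-monoˡ-≤ (W₁ ^ j * 1) (≤-trans (∏-mono λ y → G≤1 y []) (≤-reflexive (trans (∏-const R 1) (^-zeroˡ R)))) ⟩
      1 * (W₁ ^ j * 1)          ≡⟨ trans (*-identityˡ _) (*-identityʳ _) ⟩
      W₁ ^ j                    ≤⟨ m≤m*n (W₁ ^ j) (Z ^ j * 1 * 1) {{>-nonZero 0<Z^j*1*1}} ⟩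
      W₁ ^ j * (Z ^ j * 1 * 1)  ≤⟨ m≤m+n _ _ ⟩
      _                         ∎
      where
      open ≤-Reasoning
      instance
        k≢0 : NonZero k
        k≢0 = m*n≢0⇒n≢0 R
      0<Z^j*1*1 : 0 < Z ^ j * 1 * 1
      0<Z^j*1*1 = ≤-trans (m^n>0 Z {{m^n≢0 k R}} j) (≤-reflexive (sym (trans (*-identityʳ _) (*-identityʳ _))))
    count-bound (suc V) (suc j) G G≤1 = begin
      count (suc V) G * (W₁ ^ suc j * K₀ ^ suc V)
        ≡⟨ trans (cong (_* (W₁ ^ suc j * K₀ ^ suc V)) (count-suc V G)) (lem₁ _ (W₁ ^ suc j) K₀ (K₀ ^ V)) ⟩
      K₀ * (C * sumOver (words R) (λ s → ⟦ S s ⟧ * count V (slice G s)))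
        ≡⟨ cong (K₀ *_) (∑-* (words R) C _) ⟨
      K₀ * sumOver (words R) (λ s → C * (⟦ S s ⟧ * count V (slice G s)))
        ≤⟨ *-monoʳ-≤ K₀ (∑-mono (words R) λ s → per-row s (S s) (marked s)) ⟩
      K₀ * sumOver (words R) (λ s → P * c₁ s + Q * c₂ s)
        ≡⟨ cong (K₀ *_) (trans (∑-+ (words R) _ _) (cong₂ _+_ (∑-* (words R) P c₁) (∑-* (words R) Q c₂))) ⟩
      K₀ * (P * sumOver (words R) c₁ + Q * sumOver (words R) c₂)
        ≡⟨ lem₂ K₀ P _ Q _ ⟩
      K₀ * P * sumOver (words R) c₁ + Q * (K₀ * sumOver (words R) c₂)
        ≤⟨ +-mono-≤ (*-monoʳ-≤ (K₀ * P) h₁) (*-monoʳ-≤ Q h₂) ⟩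
      K₀ * P * (Z * suc M) + Q * (W₀ * K₁ * capacity (suc V) G)
        ≡⟨ cong₂ _+_ (lem₃ K₀ (W₁ ^ suc j) (Z ^ j) (suc M ^ V) (K₀ ^ V) Z (suc M)) (lem₄ (W₀ ^ j) (K₁ ^ V) W₀ K₁ _) ⟩
      W₁ ^ suc j * (Z ^ suc j * suc M ^ suc V * K₀ ^ suc V) + W₀ ^ suc j * (K₁ ^ suc V * capacity (suc V) G) ∎
      where
      open ≤-Reasoning
      g : Fin R → Fin k → ℕ
      g y i = sumOver (words V) (λ v → G y (i ∷ v))
      marked = proj₁ (step g)
      h₁ = proj₁ (proj₂ (step g))
      h₂ = proj₂ (proj₂ (step g))
      C P Q : ℕ
      C = W₁ ^ suc j * K₀ ^ V
      P = W₁ ^ suc j * (Z ^ j * suc M ^ V * K₀ ^ V)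
      Q = W₀ ^ j * K₁ ^ V
      c₁ c₂ : Vec (Fin k) R → ℕ
      c₁ s = ⟦ S s ⟧ * (if marked s then 1 else Z)
      c₂ s = ⟦ S s ⟧ * (weight g s * (if marked s then W₁ else W₀))

      lem₁ : ∀ a b c d → a * (b * (c * d)) ≡ c * (b * d * a)
      lem₁ = solve-∀
      lem₂ : ∀ a b c d e → a * (b * c + d * e) ≡ a * b * c + d * (a * e)
      lem₂ = solve-∀
      lem₃ : ∀ K W z m κ Z M → K * (W * (z * m * κ)) * (Z * M) ≡ W * ((Z * z) * (M * m) * (K * κ))
      lem₃ = solve-∀
      lem₄ : ∀ w κ W K c → w * κ * (W * K * c) ≡ W * w * (K * κ * c)
      lem₄ = solve-∀
      lem₅ : ∀ W w κ n → W * w * κ * (1 * n) ≡ W * (n * (w * κ))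
      lem₅ = solve-∀
      lem₆ : ∀ W w a b κ v → W * (w * a + b * (κ * v)) ≡ W * w * a * (1 * 1) + b * κ * (1 * (v * W))
      lem₆ = solve-∀
      lem₇ : ∀ w Z z m κ W b K v →
        w * (Z * z * m * κ) + W * b * (K * v) ≡ w * (z * m * κ) * (1 * Z) + b * K * (1 * (v * W))
      lem₇ = solve-∀
      lem₈ : ∀ w κ n → w * κ * (1 * n) ≡ n * (w * κ)
      lem₈ = solve-∀

      IH : ∀ j s → count V (slice G s) * (W₁ ^ j * K₀ ^ V) ≤
        W₁ ^ j * (Z ^ j * suc M ^ V * K₀ ^ V) + W₀ ^ j * (K₁ ^ V * weight g s)
      IH j s = ≤-trans (count-bound V j (slice G s) λ y v → G≤1 y (lookup s y ∷ v))
        (≤-reflexive (cong (λ w → W₁ ^ j * (Z ^ j * suc M ^ V * K₀ ^ V) + W₀ ^ j * (K₁ ^ V * w)) (capacity-slice g s)))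

      -- A marked row uses up one of the `suc j` marks and falls back on the hypothesis for `j`; an
      -- unmarked row keeps them all. The power of `Z` drops by one exactly at the marked rows,
      -- which is why `c₁` weighs them 1 and the others `Z`.
      per-row : ∀ s a m → C * (⟦ a ⟧ * count V (slice G s)) ≤
        P * (⟦ a ⟧ * (if m then 1 else Z)) + Q * (⟦ a ⟧ * (weight g s * (if m then W₁ else W₀)))
      per-row s false m = ≤-trans (≤-reflexive (*-zeroʳ C)) z≤n
      per-row s true true = begin
        C * (1 * count V (slice G s))                   ≡⟨ lem₅ W₁ (W₁ ^ j) (K₀ ^ V) _ ⟩
        W₁ * (count V (slice G s) * (W₁ ^ j * K₀ ^ V))  ≤⟨ *-monoʳ-≤ W₁ (IH j s) ⟩
        W₁ * (W₁ ^ j * (Z ^ j * suc M ^ V * K₀ ^ V) + W₀ ^ j * (K₁ ^ V * weight g s))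
          ≡⟨ lem₆ W₁ (W₁ ^ j) (Z ^ j * suc M ^ V * K₀ ^ V) (W₀ ^ j) (K₁ ^ V) _ ⟩
        P * (1 * 1) + Q * (1 * (weight g s * W₁)) ∎
      per-row s true false = begin
        C * (1 * count V (slice G s))               ≡⟨ lem₈ (W₁ ^ suc j) (K₀ ^ V) _ ⟩
        count V (slice G s) * (W₁ ^ suc j * K₀ ^ V) ≤⟨ IH (suc j) s ⟩
        W₁ ^ suc j * (Z ^ suc j * suc M ^ V * K₀ ^ V) + W₀ ^ suc j * (K₁ ^ V * weight g s)
          ≡⟨ lem₇ (W₁ ^ suc j) Z (Z ^ j) (suc M ^ V) (K₀ ^ V) W₀ (W₀ ^ j) (K₁ ^ V) _ ⟩
        P * (1 * Z) + Q * (1 * (weight g s * W₀)) ∎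

-- Consequences of the counting bound

bernoulli : ∀ D m → (D + m) * D ^ m ≤ D * suc D ^ m
bernoulli D zero    = ≤-reflexive (cong (_* 1) (+-identityʳ D))
bernoulli D (suc m) = begin
  (D + suc m) * (D * D ^ m)                   ≤⟨ m≤m+n _ (m * D ^ m) ⟩
  (D + suc m) * (D * D ^ m) + m * D ^ m       ≡⟨ lem D m (D ^ m) ⟩
  suc D * ((D + m) * D ^ m)                   ≤⟨ *-monoʳ-≤ (suc D) (bernoulli D m) ⟩
  suc D * (D * suc D ^ m)                     ≡⟨ lem′ D (suc D ^ m) ⟩
  D * (suc D * suc D ^ m)                     ∎
  where
  open ≤-Reasoning
  lem : ∀ D m p → (D + (1 + m)) * (D * p) + m * p ≡ (1 + D) * ((D + m) * p)
  lem = solve-∀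
  lem′ : ∀ D p → (1 + D) * (D * p) ≡ D * ((1 + D) * p)
  lem′ = solve-∀

-- The gap between `D` and `suc D` is the least that a strict inequality of integers guarantees; the
-- exponent `c * D` amplifies it to a factor `suc c`.
suc^-multiple : ∀ c D .{{_ : NonZero D}} → suc c * D ^ (c * D) ≤ suc D ^ (c * D)
suc^-multiple c D = *-cancelˡ-≤ D (≤-trans (≤-reflexive (lem D c (D ^ (c * D)))) (bernoulli D (c * D)))
  where
  lem : ∀ D c p → D * ((1 + c) * p) ≡ (D + c * D) * p
  lem = solve-∀

-- (1 + 1/(2D))ⁱ ≤ 1 + i/D for i ≤ D
compound : ∀ D i → i ≤ D → suc (2 * D) ^ i * D ≤ (2 * D) ^ i * (D + i)
compound D zero    i≤D = ≤-reflexive (cong (1 *_) (sym (+-identityʳ D)))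
compound D (suc i) i<D = begin
  suc (2 * D) ^ suc i * D           ≡⟨ *-assoc (suc (2 * D)) (suc (2 * D) ^ i) D ⟩
  suc (2 * D) * (suc (2 * D) ^ i * D) ≤⟨ *-monoʳ-≤ (suc (2 * D)) (compound D i (<⇒≤ i<D)) ⟩
  suc (2 * D) * ((2 * D) ^ i * (D + i)) ≡⟨ lem D ((2 * D) ^ i) i ⟩
  (2 * D) ^ i * (D + i + 2 * D * (D + i))  ≤⟨ *-monoʳ-≤ ((2 * D) ^ i) (+-monoˡ-≤ (2 * D * (D + i)) (+-monoʳ-≤ D (<⇒≤ i<D))) ⟩
  (2 * D) ^ i * (D + D + 2 * D * (D + i)) ≡⟨ lem′ D ((2 * D) ^ i) i ⟩
  (2 * D) ^ suc i * (D + suc i)     ∎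
  where
  open ≤-Reasoning
  lem : ∀ D p i → (1 + 2 * D) * (p * (D + i)) ≡ p * (D + i + 2 * D * (D + i))
  lem = solve-∀
  lem′ : ∀ D p i → p * (D + D + 2 * D * (D + i)) ≡ 2 * D * p * (D + (1 + i))
  lem′ = solve-∀

^-distribʳ-* : ∀ m n p → (m * n) ^ p ≡ m ^ p * n ^ p
^-distribʳ-* m n zero    = refl
^-distribʳ-* m n (suc p) = trans (cong (m * n *_) (^-distribʳ-* m n p)) (lem m n (m ^ p) (n ^ p))
  where
  lem : ∀ a b c d → a * b * (c * d) ≡ a * c * (b * d)
  lem = solve-∀

^-cancelˡ-≤ : ∀ {a b} n .{{_ : NonZero n}} → a ^ n ≤ b ^ n → a ≤ b
^-cancelˡ-≤ n h = ≮⇒≥ λ b<a → <⇒≱ (^-monoˡ-< n b<a) h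

^-swap : ∀ a m n → (a ^ m) ^ n ≡ (a ^ n) ^ m
^-swap a m n = trans (^-*-assoc a m n) (trans (cong (a ^_) (*-comm m n)) (sym (^-*-assoc a n m)))

-- The integer part of the `D`-th root of `H`. Template sizes are integers, so rounding down loses
-- nothing in a bound for them.
root : ∀ D H .{{_ : NonZero D}} → 1 ≤ H → ∃[ M ] NonZero M × M ^ D ≤ H × (∀ m → m ^ D ≤ H → m ≤ M)
root D H 1≤H = search H λ m m^D≤H → ≤-trans (m≤m^D m D) m^D≤H
  where
  m≤m^D : ∀ m D .{{_ : NonZero D}} → m ≤ m ^ D
  m≤m^D zero      D       = z≤n
  m≤m^D m@(suc _) (suc D) = m≤m*n m (m ^ D) {{m^n≢0 m D}}
  search : ∀ b → (∀ m → m ^ D ≤ H → m ≤ b) → ∃[ M ] NonZero M × M ^ D ≤ H × (∀ m → m ^ D ≤ H → m ≤ M)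
  search zero    ≤0 = contradiction (≤0 1 (≤-trans (≤-reflexive (^-zeroˡ D)) 1≤H)) λ ()
  search (suc b) ≤b with suc b ^ D ≤? H
  ... | yes h = suc b , _ , h , ≤b
  ... | no ¬h = search b λ m h → s≤s⁻¹ (≤∧≢⇒< (≤b m h) λ { refl → ¬h h })

-- Choice of the constants and the exponential gain

module Gain {k R : ℕ} .{{_ : NonZero k}} .{{_ : NonZero R}} (S : Vec (Fin k) R → Bool)
  (M : ℕ) .{{_ : NonZero M}}
  (M-bound : ∀ T → (∀ s → box T s ≡ true → S s ≡ true) → (∏ λ y → sum λ i → ⟦ T y i ⟧) ≤ M) where

  private
    -- `β` is `Z * Z`. Later `V = c * v` with `2 * v` marks, so `c` is a power of two in order to
    -- divide `V`, and is so large that `2 * β ≤ 2 ^ c`.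
    β c : ℕ
    β = k ^ R * k ^ R
    c = 2 ^ suc β

    instance
      Rk≢0 : NonZero (R * k)
      Rk≢0 = m*n≢0 R k
      c≢0 : NonZero c
      c≢0 = m^n≢0 2 (suc β)
      2c≢0 : NonZero (2 * c)
      2c≢0 = m*n≢0 2 c
      RkX≢0 : NonZero (R * k * (2 * c))
      RkX≢0 = m*n≢0 (R * k) (2 * c)

  open Counting S M M-bound (2 * c) hiding (c)
  open Matrices S

  private
    instance
      W₀≢0 : NonZero W₀
      W₀≢0 = m^n≢0 _ R
      K₀≢0 : NonZero K₀
      K₀≢0 = m*n≢0 W₀ (2 * c)

    -- With `X = 2 * c` the number `K₀` is twice `c * W₀`, as `compound` requires: `c` ordinary rows
    -- together lose no more than one mark gains.
    K₁^c≤ : K₁ ^ c * W₀ ≤ K₀ ^ c * W₁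
    K₁^c≤ = *-cancelˡ-≤ c (begin
      c * (K₁ ^ c * W₀)                    ≡⟨ lem₂ c (K₁ ^ c) W₀ ⟩
      K₁ ^ c * (c * W₀)                    ≡⟨ cong (λ K → suc K ^ c * (c * W₀)) K₀≡ ⟩
      suc (2 * (c * W₀)) ^ c * (c * W₀)    ≤⟨ compound (c * W₀) c (m≤m*n c W₀) ⟩
      (2 * (c * W₀)) ^ c * (c * W₀ + c)    ≡⟨ cong (λ K → K ^ c * (c * W₀ + c)) K₀≡ ⟨
      K₀ ^ c * (c * W₀ + c)                ≡⟨ lem₃ c (K₀ ^ c) W₀ ⟩
      c * (K₀ ^ c * W₁)                    ∎)
      where
      open ≤-Reasoning
      lem₁ : ∀ W c → W * (2 * c) ≡ 2 * (c * W)
      lem₁ = solve-∀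
      K₀≡ : K₀ ≡ 2 * (c * W₀)
      K₀≡ = lem₁ W₀ c
      lem₂ : ∀ c K W → c * (K * W) ≡ K * (c * W)
      lem₂ = solve-∀
      lem₃ : ∀ c K W → K * (c * W + c) ≡ c * (K * (1 + W))
      lem₃ = solve-∀

    K₁^V≤ : ∀ v → K₁ ^ (c * v) * W₀ ^ v ≤ K₀ ^ (c * v) * W₁ ^ v
    K₁^V≤ v = begin
      K₁ ^ (c * v) * W₀ ^ v   ≡⟨ cong (_* W₀ ^ v) (^-*-assoc K₁ c v) ⟨
      (K₁ ^ c) ^ v * W₀ ^ v   ≡⟨ ^-distribʳ-* (K₁ ^ c) W₀ v ⟨
      (K₁ ^ c * W₀) ^ v       ≤⟨ ^-monoˡ-≤ v K₁^c≤ ⟩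
      (K₀ ^ c * W₁) ^ v       ≡⟨ ^-distribʳ-* (K₀ ^ c) W₁ v ⟩
      (K₀ ^ c) ^ v * W₁ ^ v   ≡⟨ cong (_* W₁ ^ v) (^-*-assoc K₀ c v) ⟩
      K₀ ^ (c * v) * W₁ ^ v   ∎
      where open ≤-Reasoning

    -- The 4 is 2 times 2: one factor turns `suc M` into `2 * M`, the other, taken over `c * v`
    -- rows, absorbs the leading 2 and the power of `Z`.
    few-marks : ∀ v .{{_ : NonZero v}} → 2 * (Z ^ (2 * v) * suc M ^ (c * v)) ≤ (4 * M) ^ (c * v)
    few-marks v = begin
      2 * (Z ^ (2 * v) * suc M ^ (c * v))
        ≤⟨ *-mono-≤ (m≤m^n 2 v) (*-mono-≤ (≤-reflexive Z^≡) (^-monoˡ-≤ (c * v) suc-M≤)) ⟩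
      2 ^ v * ((Z * Z) ^ v * (2 * M) ^ (c * v))
        ≡⟨ trans (sym (*-assoc (2 ^ v) _ _)) (cong (_* (2 * M) ^ (c * v)) (sym (^-distribʳ-* 2 (Z * Z) v))) ⟩
      (2 * (Z * Z)) ^ v * (2 * M) ^ (c * v)
        ≤⟨ *-monoˡ-≤ ((2 * M) ^ (c * v)) (^-monoˡ-≤ v (≤-trans (*-monoʳ-≤ 2 (<⇒≤ (n<2^n β))) (^-monoʳ-≤ 2 (<⇒≤ (n<2^n (suc β)))))) ⟩
      (2 ^ c) ^ v * (2 * M) ^ (c * v)
        ≡⟨ trans (cong (_* (2 * M) ^ (c * v)) (^-*-assoc 2 c v)) (sym (^-distribʳ-* 2 (2 * M) (c * v))) ⟩
      (2 * (2 * M)) ^ (c * v)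
        ≡⟨ cong (_^ (c * v)) (sym (*-assoc 2 2 M)) ⟩
      (4 * M) ^ (c * v) ∎
      where
      open ≤-Reasoning
      m≤m^n : ∀ m n .{{_ : NonZero m}} .{{_ : NonZero n}} → m ≤ m ^ n
      m≤m^n m (suc n) = m≤m*n m (m ^ n) {{m^n≢0 m n}}
      Z^≡ : Z ^ (2 * v) ≡ (Z * Z) ^ v
      Z^≡ = trans (sym (^-*-assoc Z 2 v)) (cong (λ z → (Z * z) ^ v) (*-identityʳ Z))
      suc-M≤ : suc M ≤ 2 * M
      suc-M≤ = ≤-trans (≤-reflexive (+-comm 1 M)) (+-monoʳ-≤ M (≤-trans (>-nonZero⁻¹ M) (≤-reflexive (sym (+-identityʳ M)))))

    -- By `few-marks` the first term of `count-bound` is at most half of the left side, so twice the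
    -- second term bounds it. Of the `2 * v` gains, `v` pay for the losses K₁ / K₀ of the `c * v`
    -- rows and `v` remain.
    many-marks : ∀ v .{{_ : NonZero v}} G → (∀ y x → G y x ≤ 1) →
      (4 * M) ^ (c * v) ≤ count (c * v) G →
      count (c * v) G * W₁ ^ v ≤ 2 * W₀ ^ v * capacity (c * v) G
    many-marks v G G≤1 h = *-cancelʳ-≤ _ _ (κ * (w₀ * w₁)) {{m*n≢0 κ _ {{m^n≢0 K₀ V}} {{m*n≢0 w₀ w₁ {{m^n≢0 W₀ v}} {{m^n≢0 W₁ v}}}}}} (begin
      N * w₁ * (κ * (w₀ * w₁))           ≡⟨ lem₁ N w₁ κ w₀ ⟩
      N * (w₁ * w₁ * κ) * w₀             ≤⟨ *-monoˡ-≤ w₀ N≤ ⟩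
      2 * (w₀ * w₀ * (κ₁ * vol)) * w₀    ≡⟨ lem₂ w₀ κ₁ vol ⟩
      2 * (w₀ * w₀) * vol * (κ₁ * w₀)    ≤⟨ *-monoʳ-≤ (2 * (w₀ * w₀) * vol) (K₁^V≤ v) ⟩
      2 * (w₀ * w₀) * vol * (κ * w₁)     ≡⟨ lem₃ w₀ vol κ w₁ ⟩
      2 * w₀ * vol * (κ * (w₀ * w₁))     ∎)
      where
      open ≤-Reasoning
      V   = c * v
      N   = count V G
      vol = capacity V G
      w₀  = W₀ ^ v
      w₁  = W₁ ^ v
      κ   = K₀ ^ V
      κ₁  = K₁ ^ V
      F   = Z ^ (2 * v) * suc M ^ V
      lem₁ : ∀ N w κ u → N * w * (κ * (u * w)) ≡ N * (w * w * κ) * u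
      lem₁ = solve-∀
      lem₂ : ∀ w κ v → 2 * (w * w * (κ * v)) * w ≡ 2 * (w * w) * v * (κ * w)
      lem₂ = solve-∀
      lem₃ : ∀ w v κ u → 2 * (w * w) * v * (κ * u) ≡ 2 * w * v * (κ * (w * u))
      lem₃ = solve-∀
      lem₄ : ∀ w F κ B → 2 * (w * (F * κ) + B) ≡ 2 * F * (w * κ) + 2 * B
      lem₄ = solve-∀
      ^2v : ∀ W → W ^ (2 * v) ≡ W ^ v * W ^ v
      ^2v W = trans (cong (W ^_) (cong (λ e → v + e) (+-identityʳ v))) (^-distribˡ-+-* W v v)
      A B : ℕ
      A = w₁ * w₁ * κ
      B = w₀ * w₀ * (κ₁ * vol)
      bound : N * A ≤ w₁ * w₁ * (F * κ) + B
      bound = subst₂ (λ a b → N * (a * κ) ≤ a * (F * κ) + b * (κ₁ * vol)) (^2v W₁) (^2v W₀)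
        (count-bound V (2 * v) G G≤1)
      N≤ : N * A ≤ 2 * B
      N≤ = +-cancelˡ-≤ (N * A) _ _ (begin
        N * A + N * A                    ≡⟨ cong (λ e → N * A + e) (+-identityʳ (N * A)) ⟨
        2 * (N * A)                      ≤⟨ *-monoʳ-≤ 2 bound ⟩
        2 * (w₁ * w₁ * (F * κ) + B)      ≡⟨ lem₄ (w₁ * w₁) F κ B ⟩
        2 * F * A + 2 * B                ≤⟨ +-monoˡ-≤ (2 * B) (*-monoˡ-≤ A (≤-trans (few-marks v) h)) ⟩
        N * A + 2 * B                    ∎)

    -- The summand `suc β` of `n₀` splits the factor `c` off `2 ^ (n₀ + m)`; the summand `2 * W₀`
    -- makes the quotient `v` at least `2 * W₀`, as `amplify` requires.
    n₀ E : ℕ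
    n₀ = suc β + 2 * W₀
    E  = W₀ * (2 * c)

    v[_] : ℕ → ℕ
    v[ m ] = 2 ^ (2 * W₀ + m)

    V≡ : ∀ m → 2 ^ (n₀ + m) ≡ c * v[ m ]
    V≡ m = trans (cong (2 ^_) (+-assoc (suc β) (2 * W₀) m)) (^-distribˡ-+-* 2 (suc β) (2 * W₀ + m))

    -- The power `W₀` turns (W₁ / W₀) ^ v into at least 2 ^ v, at the cost of the constant 2 ^ W₀.
    -- Squaring absorbs that constant, since `2 * W₀ ≤ v`, and the power `c` raises 2 ^ v to 2 ^ V.
    amplify : ∀ v N vol → 2 * W₀ ≤ v → N * W₁ ^ v ≤ 2 * W₀ ^ v * vol → N ^ E * 2 ^ (c * v) ≤ vol ^ E
    amplify v N vol 2W₀≤v h = begin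
      N ^ E * 2 ^ (c * v)                    ≡⟨ cong₂ _*_ (^-*-assoc N W₀ (2 * c)) (trans (^-*-assoc 2 v c) (cong (2 ^_) (*-comm v c))) ⟨
      (N ^ W₀) ^ (2 * c) * (2 ^ v) ^ c       ≡⟨ cong (_* (2 ^ v) ^ c) (^-*-assoc (N ^ W₀) 2 c) ⟨
      ((N ^ W₀) ^ 2) ^ c * (2 ^ v) ^ c       ≡⟨ ^-distribʳ-* ((N ^ W₀) ^ 2) (2 ^ v) c ⟨
      ((N ^ W₀) ^ 2 * 2 ^ v) ^ c             ≤⟨ ^-monoˡ-≤ c squared ⟩
      ((vol ^ W₀) ^ 2) ^ c                   ≡⟨ ^-*-assoc (vol ^ W₀) 2 c ⟩
      (vol ^ W₀) ^ (2 * c)                   ≡⟨ ^-*-assoc vol W₀ (2 * c) ⟩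
      vol ^ E                                ∎
      where
      open ≤-Reasoning
      instance
        w≢0 : NonZero ((W₀ ^ v) ^ W₀)
        w≢0 = m^n≢0 _ W₀ {{m^n≢0 W₀ v}}
      lem₁ : ∀ N p w → N * p * w ≡ N * (p * w)
      lem₁ = solve-∀
      lem₂ : ∀ a w v → a * w * v ≡ a * v * w
      lem₂ = solve-∀
      swap^ : ∀ a → (a ^ W₀) ^ v ≡ (a ^ v) ^ W₀
      swap^ a = trans (^-*-assoc a W₀ v) (trans (cong (a ^_) (*-comm W₀ v)) (sym (^-*-assoc a v W₀)))
      2*W₀^W₀≤ : 2 * W₀ ^ W₀ ≤ W₁ ^ W₀
      2*W₀^W₀≤ = subst (λ e → 2 * W₀ ^ e ≤ W₁ ^ e) (+-identityʳ W₀) (suc^-multiple 1 W₀)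
      powered : N ^ W₀ * 2 ^ v ≤ 2 ^ W₀ * vol ^ W₀
      powered = *-cancelʳ-≤ _ _ ((W₀ ^ v) ^ W₀) (begin
        N ^ W₀ * 2 ^ v * (W₀ ^ v) ^ W₀      ≡⟨ trans (lem₁ (N ^ W₀) (2 ^ v) _) (cong (λ w → N ^ W₀ * (2 ^ v * w)) (sym (swap^ W₀))) ⟩
        N ^ W₀ * (2 ^ v * (W₀ ^ W₀) ^ v)    ≡⟨ cong (N ^ W₀ *_) (^-distribʳ-* 2 (W₀ ^ W₀) v) ⟨
        N ^ W₀ * (2 * W₀ ^ W₀) ^ v          ≤⟨ *-monoʳ-≤ (N ^ W₀) (^-monoˡ-≤ v 2*W₀^W₀≤) ⟩
        N ^ W₀ * (W₁ ^ W₀) ^ v              ≡⟨ cong (N ^ W₀ *_) (swap^ W₁) ⟩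
        N ^ W₀ * (W₁ ^ v) ^ W₀              ≡⟨ ^-distribʳ-* N (W₁ ^ v) W₀ ⟨
        (N * W₁ ^ v) ^ W₀                   ≤⟨ ^-monoˡ-≤ W₀ h ⟩
        (2 * W₀ ^ v * vol) ^ W₀             ≡⟨ trans (^-distribʳ-* (2 * W₀ ^ v) vol W₀) (cong (_* vol ^ W₀) (^-distribʳ-* 2 (W₀ ^ v) W₀)) ⟩
        2 ^ W₀ * (W₀ ^ v) ^ W₀ * vol ^ W₀   ≡⟨ lem₂ (2 ^ W₀) _ (vol ^ W₀) ⟩
        2 ^ W₀ * vol ^ W₀ * (W₀ ^ v) ^ W₀   ∎)
      ^2 : ∀ a → a ^ 2 ≡ a * a
      ^2 a = cong (a *_) (*-identityʳ a)
      lem₃ : ∀ a b → a * a * b * b ≡ (a * b) * (a * b)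
      lem₃ = solve-∀
      lem₄ : ∀ a b → (a * b) * (a * b) ≡ b * b * (a * a)
      lem₄ = solve-∀
      squared : (N ^ W₀) ^ 2 * 2 ^ v ≤ (vol ^ W₀) ^ 2
      squared = *-cancelʳ-≤ _ _ (2 ^ v) {{m^n≢0 2 v}} (begin
        (N ^ W₀) ^ 2 * 2 ^ v * 2 ^ v                   ≡⟨ trans (cong (λ x → x * 2 ^ v * 2 ^ v) (^2 (N ^ W₀))) (lem₃ (N ^ W₀) (2 ^ v)) ⟩
        (N ^ W₀ * 2 ^ v) * (N ^ W₀ * 2 ^ v)            ≤⟨ *-mono-≤ powered powered ⟩
        (2 ^ W₀ * vol ^ W₀) * (2 ^ W₀ * vol ^ W₀)      ≡⟨ lem₄ (2 ^ W₀) (vol ^ W₀) ⟩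
        vol ^ W₀ * vol ^ W₀ * (2 ^ W₀ * 2 ^ W₀)        ≡⟨ cong₂ _*_ (sym (^2 (vol ^ W₀))) (trans (sym (^-distribˡ-+-* 2 W₀ W₀)) (cong (λ e → 2 ^ (W₀ + e)) (sym (+-identityʳ W₀)))) ⟩
        (vol ^ W₀) ^ 2 * 2 ^ (2 * W₀)                  ≤⟨ *-monoʳ-≤ ((vol ^ W₀) ^ 2) (^-monoʳ-≤ 2 2W₀≤v) ⟩
        (vol ^ W₀) ^ 2 * 2 ^ v                         ∎)

  -- `E` and `n₀` are fixed before `m` and `G`, so that one exponent serves every step of the
  -- iteration in `no-fast-growth`.
  gain : ∃[ E ] ∃[ n₀ ] ∀ m (G : Fin R → Vec (Fin k) (2 ^ (n₀ + m)) → ℕ) → (∀ y x → G y x ≤ 1) →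
    (4 * M) ^ 2 ^ (n₀ + m) ≤ count _ G →
    count _ G ^ E * 2 ^ 2 ^ (n₀ + m) ≤ capacity _ G ^ E
  gain = E , n₀ , λ m → subst
    (λ V → (G : Fin R → Vec (Fin k) V → ℕ) → (∀ y x → G y x ≤ 1) → (4 * M) ^ V ≤ count V G →
      count V G ^ E * 2 ^ V ≤ capacity V G ^ E)
    (sym (V≡ m))
    λ G G≤1 h → amplify v[ m ] _ _ (≤-trans (m≤m+n (2 * W₀) m) (<⇒≤ (n<2^n (2 * W₀ + m))))
      (many-marks v[ m ] {{m^n≢0 2 (2 * W₀ + m)}} G G≤1 h)

-- Hypercubes

encode : ∀ {n} → Cube n → Fin (2 ^ n)
encode []      = zero
encode (b ∷ x) = combine (Inverse.from Finₚ.2↔Bool b) (encode x)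

decode : ∀ {n} → Fin (2 ^ n) → Cube n
decode {zero}  i = []
decode {suc n} i = Inverse.to Finₚ.2↔Bool (proj₁ (remQuot {2} (2 ^ n) i)) ∷ decode (proj₂ (remQuot {2} (2 ^ n) i))

decode-encode : ∀ {n} (x : Cube n) → decode (encode x) ≡ x
decode-encode [] = refl
decode-encode {suc n} (b ∷ x) = cong₂ _∷_
  (trans (cong (Inverse.to Finₚ.2↔Bool ∘ proj₁) inv) (Inverse.strictlyInverseˡ Finₚ.2↔Bool b))
  (trans (cong (decode ∘ proj₂) inv) (decode-encode x))
  where inv = Finₚ.remQuot-combine (Inverse.from Finₚ.2↔Bool b) (encode x)

encode-decode : ∀ {n} (i : Fin (2 ^ n)) → encode {n} (decode i) ≡ i
encode-decode {zero}  zero = refl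
encode-decode {suc n} i = trans
  (cong₂ combine (Inverse.strictlyInverseʳ Finₚ.2↔Bool (proj₁ qr)) (encode-decode {n} (proj₂ qr)))
  (Finₚ.combine-remQuot {2} (2 ^ n) i)
  where qr = remQuot {2} (2 ^ n) i

-- Recursion on the dimension as in `∑`, so that `log-*` alone carries the logarithm through it;
-- `∏-encode` links it to products over positions.
∏ᶜ : ∀ n → (Cube n → ℕ) → ℕ
∏ᶜ zero    f = f []
∏ᶜ (suc n) f = ∏ᶜ n (f ∘ (false ∷_)) * ∏ᶜ n (f ∘ (true ∷_))

∏ᶜ-cong : ∀ n {f g : Cube n → ℕ} → f ≗ g → ∏ᶜ n f ≡ ∏ᶜ n g
∏ᶜ-cong zero    f≗g = f≗g []
∏ᶜ-cong (suc n) f≗g = cong₂ _*_ (∏ᶜ-cong n (f≗g ∘ (false ∷_))) (∏ᶜ-cong n (f≗g ∘ (true ∷_)))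

∏-++ : ∀ m n (f : Fin (m + n) → ℕ) → ∏ f ≡ ∏ (f ∘ (_↑ˡ n)) * ∏ (f ∘ (m ↑ʳ_))
∏-++ zero    n f = sym (+-identityʳ _)
∏-++ (suc m) n f = trans (cong (f zero *_) (∏-++ m n (f ∘ suc))) (sym (*-assoc (f zero) _ _))

∏-encode : ∀ n (f : Fin (2 ^ n) → ℕ) → ∏ᶜ n (f ∘ encode) ≡ ∏ f
∏-encode zero    f = sym (*-identityʳ _)
∏-encode (suc n) f = begin
  ∏ᶜ n (fˡ ∘ encode) * ∏ᶜ n (fʳ ∘ (_↑ˡ 0) ∘ encode)  ≡⟨ cong₂ _*_ (∏-encode n fˡ) (∏-encode n (fʳ ∘ (_↑ˡ 0))) ⟩
  ∏ fˡ * ∏ (fʳ ∘ (_↑ˡ 0))                            ≡⟨ cong (∏ fˡ *_) (trans (∏-++ V 0 fʳ) (*-identityʳ _)) ⟨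
  ∏ fˡ * ∏ fʳ                                        ≡⟨ ∏-++ V (V + 0) f ⟨
  ∏ f                                                ∎
  where
  open ≡-Reasoning
  V = 2 ^ n
  fˡ : Fin V → ℕ
  fˡ = f ∘ (_↑ˡ (V + 0))
  fʳ : Fin (V + 0) → ℕ
  fʳ = f ∘ (V ↑ʳ_)

-- Composing a colouring with `prefixed x` reads off a row of its matrix, and with `suffixed y` a
-- column.
prefixed : ∀ {n r} → Cube n → OrderEmbedding r (n + r)
prefixed {n} {r} x = record
  { φ = x ++_ ; b = n ↑ʳ_
  ; increasing = λ {i} {j} i<j → subst₂ _<_ (sym (Finₚ.toℕ-↑ʳ n i)) (sym (Finₚ.toℕ-↑ʳ n j)) (+-monoʳ-< n i<j)
  ; active = λ y j → Vecₚ.lookup-++ʳ x y j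
  ; fixed = fix }
  where
  fix : ∀ y i → (∀ j → n ↑ʳ j ≢ i) → lookup (x ++ y) i ≡ lookup (x ++ replicate r false) i
  fix y i inactive with splitAt n i in eq
  ... | inj₁ i′ rewrite sym (Finₚ.splitAt⁻¹-↑ˡ {m = n} eq) =
    trans (Vecₚ.lookup-++ˡ x y i′) (sym (Vecₚ.lookup-++ˡ x _ i′))
  ... | inj₂ j  = contradiction (Finₚ.splitAt⁻¹-↑ʳ {m = n} eq) (inactive j)

suffixed : ∀ {n r} → Cube r → OrderEmbedding n (n + r)
suffixed {n} {r} y = record
  { φ = _++ y ; b = _↑ˡ r
  ; increasing = λ {i} {j} i<j → subst₂ _<_ (sym (Finₚ.toℕ-↑ˡ i r)) (sym (Finₚ.toℕ-↑ˡ j r)) i<j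
  ; active = λ x j → Vecₚ.lookup-++ˡ x y j
  ; fixed = fix }
  where
  fix : ∀ x i → (∀ j → j ↑ˡ r ≢ i) → lookup (x ++ y) i ≡ lookup (replicate n false ++ y) i
  fix x i inactive with splitAt n i in eq
  ... | inj₁ j  = contradiction (Finₚ.splitAt⁻¹-↑ˡ {m = n} eq) (inactive j)
  ... | inj₂ i′ rewrite sym (Finₚ.splitAt⁻¹-↑ʳ {m = n} eq) =
    trans (Vecₚ.lookup-++ʳ x y i′) (sym (Vecₚ.lookup-++ʳ (replicate n false) y i′))

sum-∣∣ : ∀ {k} (p : Subset k) → sum (λ i → ⟦ lookup p i ⟧) ≡ ∣ p ∣
sum-∣∣ []          = refl
sum-∣∣ (true ∷ p)  = cong suc (sum-∣∣ p)
sum-∣∣ (false ∷ p) = sum-∣∣ p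

∏≡0 : ∀ {n} (f : Fin n → ℕ) i → f i ≡ 0 → ∏ f ≡ 0
∏≡0 f zero    h rewrite h = refl
∏≡0 f (suc i) h = trans (cong (f zero *_) (∏≡0 (f ∘ suc) i h)) (*-zeroʳ (f zero))

positive : ∀ b → Fin ⟦ b ⟧ → b ≡ true
positive true _ = refl

-- Sizes of hereditary properties

module Speed (em : ExcludedMiddle 0ℓ) {k} (P : Property k) (her : OrderHereditary P)
  (size : ℕ → ℕ) (hasSize : ∀ n → HasSize P n (size n)) where

  colouring : ∀ n → Vec (Fin k) (2 ^ n) → Colouring k n
  colouring n w x = lookup w (encode x)

  -- Excluded middle decides membership, which turns P_n into a 0/1-valued function on words that
  -- can be summed.
  inP : ∀ n → Vec (Fin k) (2 ^ n) → Bool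
  inP n w = does (em {member P n (colouring n w)})

  inP⇒ : ∀ n w → inP n w ≡ true → member P n (colouring n w)
  inP⇒ n w = does-true em

  ⇒inP : ∀ n w → member P n (colouring n w) → inP n w ≡ true
  ⇒inP n w = dec-true em

  ∑-inP≤size : ∀ n → sumOver (words (2 ^ n)) (λ w → ⟦ inP n w ⟧) ≤ size n
  ∑-inP≤size n = ∑≤injection (words (2 ^ n)) _ (λ w → ⟦⟧≤1 (inP n w))
    (λ w x → to (colouring n w , inP⇒ n w (positive (inP n w) x)))
    (λ {w} {w′} {x} {x′} e → lookup-injective λ i → begin
      lookup w i                     ≡⟨ cong (lookup w) (encode-decode {n} i) ⟨
      colouring n w (decode i)       ≡⟨ strictlyInverseʳ (colouring n w , inP⇒ n w (positive (inP n w) x)) (decode i) ⟨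
      proj₁ (from (to _)) (decode i) ≡⟨ from-cong e (decode i) ⟩
      proj₁ (from (to _)) (decode i) ≡⟨ strictlyInverseʳ (colouring n w′ , inP⇒ n w′ (positive (inP n w′) x′)) (decode i) ⟩
      colouring n w′ (decode i)      ≡⟨ cong (lookup w′) (encode-decode {n} i) ⟩
      lookup w′ i                    ∎)
    where
    open ≡-Reasoning
    open Inverse (hasSize n)
    lookup-injective : ∀ {m} {w w′ : Vec (Fin k) m} → lookup w ≗ lookup w′ → w ≡ w′
    lookup-injective {w = w} {w′} h = trans (sym (Vecₚ.tabulate∘lookup w)) (trans (Vecₚ.tabulate-cong h) (Vecₚ.tabulate∘lookup w′))

  size≢0 : ∀ n → ∃ (member P n) → NonZero (size n)
  size≢0 n c with size n | Inverse.to (hasSize n) c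
  ... | suc _ | _ = _

  template≤size : ∀ n (t : Template k n) → ⟨ t ⟩ ⊆ member P n → ∏ᶜ n (λ x → ∣ palette t x ∣) ≤ size n
  template≤size n t t⊆P = begin
    ∏ᶜ n (λ x → ∣ palette t x ∣)
      ≡⟨ ∏ᶜ-cong n (λ x → trans (cong (λ x → ∣ palette t x ∣) (sym (decode-encode x))) (sym (sum-∣∣ (palette t (decode (encode x)))))) ⟩
    ∏ᶜ n (λ x → sum λ i → ⟦ T (encode x) i ⟧)
      ≡⟨ ∏-encode n (λ y → sum λ i → ⟦ T y i ⟧) ⟩
    (∏ λ y → sum λ i → ⟦ T y i ⟧)
      ≡⟨ ∑-box (2 ^ n) T ⟨
    sumOver (words (2 ^ n)) (λ w → ⟦ box T w ⟧)
      ≤⟨ ∑-mono (words (2 ^ n)) (λ w → imp (box T w) (inP n w) (λ h → ⇒inP n w (t⊆P (fit w h)))) ⟩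
    sumOver (words (2 ^ n)) (λ w → ⟦ inP n w ⟧)
      ≤⟨ ∑-inP≤size n ⟩
    size n ∎
    where
    open ≤-Reasoning
    T : Fin (2 ^ n) → Fin k → Bool
    T y i = lookup (palette t (decode y)) i
    imp : ∀ a b → (a ≡ true → b ≡ true) → ⟦ a ⟧ ≤ ⟦ b ⟧
    imp false b h = z≤n
    imp true  b h rewrite h refl = ≤-refl
    fit : ∀ w → box T w ≡ true → ⟨ t ⟩ (colouring n w)
    fit w h x = Vecₚ.lookup⇒[]= (colouring n w x) (palette t x)
      (subst (λ z → lookup (palette t z) (colouring n w x) ≡ true) (decode-encode x) (box⇒ T w h (encode x)))

  module _ (n r : ℕ) where
    open Matrices (inP r)

    -- Heredity along the two embeddings puts the rows into P_r and the columns into P_n. Only an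
    -- inequality results, since a matrix with such rows and columns need not come from a member of
    -- P.
    size≤count : size (n + r) ≤ count (2 ^ n) (λ _ w → ⟦ inP n w ⟧)
    size≤count = injection⇒≤∑ (matrices (2 ^ n)) _ matrix
      (λ {i} {j} e → trans (sym (strictlyInverseˡ i)) (trans (to-cong (matrix-injective i j e)) (strictlyInverseˡ j)))
      (λ i → fits-pos _ (matrix i) (row∈P i) (λ y → ≤-reflexive (sym (cong ⟦_⟧ (column∈P i y)))))
      where
      open Inverse (hasSize (n + r))
      matrix : Fin (size (n + r)) → Vec (Vec (Fin k) (2 ^ r)) (2 ^ n)
      matrix i = tabulate λ X → tabulate λ Y → proj₁ (from i) (decode {n} X ++ decode {r} Y)

      entry : ∀ i X Y → lookup (lookup (matrix i) X) Y ≡ proj₁ (from i) (decode {n} X ++ decode {r} Y)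
      entry i X Y = trans (cong (λ s → lookup s Y) (Vecₚ.lookup∘tabulate _ X)) (Vecₚ.lookup∘tabulate _ Y)

      matrix-injective : ∀ i j → matrix i ≡ matrix j → proj₁ (from i) ≗ proj₁ (from j)
      matrix-injective i j e z = begin
        proj₁ (from i) z                           ≡⟨ cong (proj₁ (from i)) z≡ ⟩
        proj₁ (from i) (decode {n} X ++ decode {r} Y)      ≡⟨ entry i X Y ⟨
        lookup (lookup (matrix i) X) Y             ≡⟨ cong (λ m → lookup (lookup m X) Y) e ⟩
        lookup (lookup (matrix j) X) Y             ≡⟨ entry j X Y ⟩
        proj₁ (from j) (decode {n} X ++ decode {r} Y)      ≡⟨ cong (proj₁ (from j)) z≡ ⟨
        proj₁ (from j) z                           ∎
        where
        open ≡-Reasoning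
        X : Fin (2 ^ n)
        X = encode (take n z)
        Y : Fin (2 ^ r)
        Y = encode (drop n z)
        z≡ : z ≡ decode {n} X ++ decode {r} Y
        z≡ = trans (sym (Vecₚ.take++drop≡id n z)) (sym (cong₂ _++_ (decode-encode (take n z)) (decode-encode (drop n z))))

      row∈P : ∀ i X → inP r (lookup (matrix i) X) ≡ true
      row∈P i X = ⇒inP r (lookup (matrix i) X) (respects P
        (λ y → sym (trans (entry i X (encode y)) (cong (λ y → proj₁ (from i) (decode {n} X ++ y)) (decode-encode y))))
        (her {m = r} {n = n + r} _ (prefixed (decode {n} X)) (proj₂ (from i))))

      column∈P : ∀ i Y → inP n (Vec.map (λ s → lookup s Y) (matrix i)) ≡ true
      column∈P i Y = ⇒inP n (Vec.map (λ s → lookup s Y) (matrix i)) (respects P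
        (λ x → sym (trans (Vecₚ.lookup-map (encode x) (λ s → lookup s Y) (matrix i))
          (trans (entry i (encode x) Y) (cong (λ x → proj₁ (from i) (x ++ decode {r} Y)) (decode-encode x)))))
        (her {m = n} {n = n + r} _ (suffixed (decode {r} Y)) (proj₂ (from i))))

    capacity≤ : capacity (2 ^ n) (λ _ w → ⟦ inP n w ⟧) ≤ size n ^ 2 ^ r
    capacity≤ = ≤-trans (∏-mono {2 ^ r} λ _ → ∑-inP≤size n) (≤-reflexive (∏-const (2 ^ r) (size n)))

    size-submultiplicative : size (n + r) ≤ size n ^ 2 ^ r
    size-submultiplicative = ≤-trans size≤count (≤-trans (count≤capacity (2 ^ n) _) capacity≤)

  -- Boxes differ from templates in that a side may be empty, but then the product is 0. All other
  -- boxes are templates.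
  box-bound : ∀ r M → (∀ t → ⟨ t ⟩ ⊆ member P r → ∏ᶜ r (λ x → ∣ palette t x ∣) ≤ M) →
    ∀ T → (∀ s → box T s ≡ true → inP r s ≡ true) → (∏ λ y → sum λ i → ⟦ T y i ⟧) ≤ M
  box-bound r M h T T⊆P with em {∃[ y ] (sum λ i → ⟦ T y i ⟧) ≡ 0}
  ... | yes (y , empty) = ≤-trans (≤-reflexive (∏≡0 (λ y → sum λ i → ⟦ T y i ⟧) y empty)) z≤n
  ... | no ¬empty = begin
    (∏ λ y → sum λ i → ⟦ T y i ⟧)                     ≤⟨ ∏-mono (λ y → ≤-reflexive (sum-T y)) ⟩
    (∏ λ y → ∣ tabulate (T y) ∣)                      ≡⟨ ∏-encode r (λ y → ∣ tabulate (T y) ∣) ⟨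
    ∏ᶜ r (λ x → ∣ tabulate (T (encode x)) ∣)          ≤⟨ h t t⊆P ⟩
    M                                                 ∎
    where
    open ≤-Reasoning
    sum-T : ∀ y → (sum λ i → ⟦ T y i ⟧) ≡ ∣ tabulate (T y) ∣
    sum-T y = trans (∑-cong (finSummation k) λ i → cong ⟦_⟧ (sym (Vecₚ.lookup∘tabulate (T y) i))) (sum-∣∣ (tabulate (T y)))
    ne : ∀ y → Subset.Nonempty (tabulate (T y))
    ne y with ∑≡0⊎∃ (finSummation k) (λ i → ⟦ T y i ⟧)
    ... | inj₁ none = contradiction (y , trans (∑-cong (finSummation k) none) (trans (sum-const k 0) (*-zeroʳ k))) ¬empty
    ... | inj₂ (i , x) = i , Vecₚ.lookup⇒[]= i _ (trans (Vecₚ.lookup∘tabulate (T y) i) (positive (T y i) x))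
    t : Template k r
    t = record { palette = λ x → tabulate (T (encode x)) ; nonempty = λ x → ne (encode x) }
    t⊆P : ⟨ t ⟩ ⊆ member P r
    t⊆P {c} c∈t = respects P
      (λ x → trans (Vecₚ.lookup∘tabulate _ (encode x)) (cong c (decode-encode x)))
      (inP⇒ r s (T⊆P s (⇒box T s λ y → trans (cong (T y) (Vecₚ.lookup∘tabulate _ y))
        (trans (sym (Vecₚ.lookup∘tabulate (T y) _)) (Vecₚ.[]=⇒lookup
          (subst (λ y′ → c (decode y) ∈ tabulate (T y′)) (encode-decode {r} y) (c∈t (decode y))))))))
      where
      s : Vec (Fin k) (2 ^ r)
      s = tabulate (c ∘ decode)

  -- Along the dimensions `n₀ + i * r`, `gain` makes log₂ (u i) / V i drop by at least 1 / R at each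
  -- step, while `u i ≥ 1` keeps it nonnegative.
  no-fast-growth : .{{_ : NonZero k}} → (∀ n → NonZero (size n)) →
    ∀ r M .{{_ : NonZero M}} →
    (∀ t → ⟨ t ⟩ ⊆ member P r → ∏ᶜ r (λ x → ∣ palette t x ∣) ≤ M) →
    ¬ (∀ n → (4 * M) ^ 2 ^ n ≤ size (n + r))
  no-fast-growth size≢0 r M t≤M fast = <⇒≱ (n<2^n (u 0 ^ R)) (≤-trans (^-monoʳ-≤ 2 (m≤m*n (u 0 ^ R) V₀)) (too-big (u 0 ^ R)))
    where
    open ≤-Reasoning
    R = 2 ^ r
    instance
      R≢0 : NonZero R
      R≢0 = m^n≢0 2 r
    module G = Gain {k} {R} (inP r) M (box-bound r M t≤M)
    E n₀ V₀ : ℕ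
    E  = proj₁ G.gain
    n₀ = proj₁ (proj₂ G.gain)
    V₀ = 2 ^ n₀
    instance
      V₀≢0 : NonZero V₀
      V₀≢0 = m^n≢0 2 n₀

    u V : ℕ → ℕ
    u i = size (n₀ + i * r) ^ E
    V i = 2 ^ (n₀ + i * r)

    V-suc : ∀ i → V (suc i) ≡ V i * R
    V-suc i = trans (cong (2 ^_) (lem n₀ r (i * r))) (^-distribˡ-+-* 2 (n₀ + i * r) r)
      where
      lem : ∀ a b c → a + (b + c) ≡ a + c + b
      lem = solve-∀

    V≡ : ∀ i → V i ≡ V₀ * R ^ i
    V≡ zero    = trans (cong (2 ^_) (+-identityʳ n₀)) (sym (*-identityʳ V₀))
    V≡ (suc i) = trans (V-suc i) (trans (cong (_* R) (V≡ i)) (lem V₀ (R ^ i) R))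
      where
      lem : ∀ a b c → a * b * c ≡ a * (c * b)
      lem = solve-∀

    u-suc : ∀ i → u (suc i) * 2 ^ V i ≤ u i ^ R
    u-suc i = begin
      u (suc i) * 2 ^ V i                ≡⟨ cong (λ n → size n ^ E * 2 ^ V i) (lem n₀ r (i * r)) ⟩
      size (n + r) ^ E * 2 ^ V i         ≤⟨ *-monoˡ-≤ (2 ^ V i) (^-monoˡ-≤ E (size≤count n r)) ⟩
      Matrices.count (inP r) (2 ^ n) _ ^ E * 2 ^ V i ≤⟨ proj₂ (proj₂ G.gain) (i * r) _ (λ _ w → ⟦⟧≤1 (inP n w)) (≤-trans (fast n) (size≤count n r)) ⟩
      Matrices.capacity (inP r) (2 ^ n) _ ^ E ≤⟨ ^-monoˡ-≤ E (capacity≤ n r) ⟩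
      (size n ^ R) ^ E                   ≡⟨ trans (^-*-assoc (size n) R E) (trans (cong (size n ^_) (*-comm R E)) (sym (^-*-assoc (size n) E R))) ⟩
      u i ^ R                            ∎
      where
      n = n₀ + i * r
      lem : ∀ a b c → a + (b + c) ≡ a + c + b
      lem = solve-∀

    accumulated : ∀ i → u i ^ R * 2 ^ (i * V i) ≤ u 0 ^ R ^ suc i
    accumulated zero    = ≤-reflexive (trans (*-identityʳ _) (cong (u 0 ^_) (sym (*-identityʳ R))))
    accumulated (suc i) = begin
      u (suc i) ^ R * 2 ^ (suc i * V (suc i))
        ≡⟨ cong (u (suc i) ^ R *_) (trans (cong (2 ^_) (trans (cong (suc i *_) (V-suc i)) (sym (*-assoc (suc i) (V i) R)))) (sym (^-*-assoc 2 (suc i * V i) R))) ⟩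
      u (suc i) ^ R * (2 ^ (V i + i * V i)) ^ R
        ≡⟨ ^-distribʳ-* (u (suc i)) _ R ⟨
      (u (suc i) * 2 ^ (V i + i * V i)) ^ R
        ≡⟨ cong (_^ R) (trans (cong (u (suc i) *_) (^-distribˡ-+-* 2 (V i) (i * V i))) (sym (*-assoc (u (suc i)) _ _))) ⟩
      (u (suc i) * 2 ^ V i * 2 ^ (i * V i)) ^ R
        ≤⟨ ^-monoˡ-≤ R (≤-trans (*-monoˡ-≤ (2 ^ (i * V i)) (u-suc i)) (accumulated i)) ⟩
      (u 0 ^ R ^ suc i) ^ R
        ≡⟨ trans (^-*-assoc (u 0) (R ^ suc i) R) (cong (u 0 ^_) (*-comm (R ^ suc i) R)) ⟩
      u 0 ^ R ^ suc (suc i) ∎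

    too-big : ∀ i → 2 ^ (i * V₀) ≤ u 0 ^ R
    too-big i = ^-cancelˡ-≤ (R ^ i) {{m^n≢0 R i}} (begin
      (2 ^ (i * V₀)) ^ R ^ i    ≡⟨ trans (^-*-assoc 2 (i * V₀) (R ^ i)) (cong (2 ^_) (trans (*-assoc i V₀ (R ^ i)) (cong (i *_) (sym (V≡ i))))) ⟩
      2 ^ (i * V i)             ≤⟨ m≤n*m _ (u i ^ R) {{m^n≢0 (u i) R {{m^n≢0 _ E {{size≢0 _}}}}}} ⟩
      u i ^ R * 2 ^ (i * V i)   ≤⟨ accumulated i ⟩
      u 0 ^ R ^ suc i           ≡⟨ ^-*-assoc (u 0) R (R ^ i) ⟨
      (u 0 ^ R) ^ R ^ i         ∎)

  -- A single large `r` suffices: `M` is the bound on template sizes in dimension `r`, and the gap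
  -- between the two fractions absorbs the factor 4.
  growth-bound : .{{_ : NonTrivial k}} → (∀ n → NonZero (size n)) →
    ∀ N₀ p₁ d₁ p₂ d₂ → p₁ * suc d₂ < p₂ * suc d₁ →
    (∀ r → N₀ ≤ r → ∀ t → ⟨ t ⟩ ⊆ member P r → ∏ᶜ r (λ x → ∣ palette t x ∣) ^ suc d₁ ≤ k ^ (p₁ * 2 ^ r)) →
    ¬ (∀ n → k ^ (p₂ * 2 ^ n) ≤ size n ^ suc d₂)
  growth-bound size≢0 N₀ p₁ d₁ p₂ d₂ p₁/d₁<p₂/d₂ small fast =
    no-fast-growth size≢0 r M
      (λ t t⊆P → let B = ∏ᶜ r (λ x → ∣ palette t x ∣) in M-max B (^D≤H B (small r (m≤m+n N₀ (2 * D)) t t⊆P)))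
      (λ n → ^-cancelˡ-≤ D (4M≤size n))
    where
    open ≤-Reasoning
    instance
      k≢0 : NonZero k
      k≢0 = nonTrivial⇒nonZero k
    D₁ D₂ D r R H : ℕ
    D₁ = suc d₁
    D₂ = suc d₂
    D  = D₁ * D₂
    -- large enough for the factor 4 in no-fast-growth to be absorbed: 4 ^ D ≤ k ^ R
    r  = N₀ + 2 * D
    R  = 2 ^ r
    H  = k ^ (p₁ * R * D₂)
    M = proj₁ (root D H (m^n>0 k (p₁ * R * D₂)))
    instance
      M≢0 : NonZero M
      M≢0 = proj₁ (proj₂ (root D H (m^n>0 k (p₁ * R * D₂))))
    M^D≤H : M ^ D ≤ H
    M^D≤H = proj₁ (proj₂ (proj₂ (root D H (m^n>0 k (p₁ * R * D₂)))))
    M-max : ∀ m → m ^ D ≤ H → m ≤ M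
    M-max = proj₂ (proj₂ (proj₂ (root D H (m^n>0 k (p₁ * R * D₂)))))

    ^D≤H : ∀ B → B ^ D₁ ≤ k ^ (p₁ * R) → B ^ D ≤ H
    ^D≤H B h = begin
      B ^ (D₁ * D₂)            ≡⟨ ^-*-assoc B D₁ D₂ ⟨
      (B ^ D₁) ^ D₂            ≤⟨ ^-monoˡ-≤ D₂ h ⟩
      (k ^ (p₁ * R)) ^ D₂      ≡⟨ ^-*-assoc k (p₁ * R) D₂ ⟩
      H                        ∎

    2≤k : 2 ≤ k
    2≤k = nonTrivial⇒n>1 k

    4^D≤ : 4 ^ D ≤ k ^ R
    4^D≤ = begin
      4 ^ D         ≡⟨ ^-*-assoc 2 2 D ⟩
      2 ^ (2 * D)   ≤⟨ ^-monoˡ-≤ (2 * D) 2≤k ⟩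
      k ^ (2 * D)   ≤⟨ ^-monoʳ-≤ k (≤-trans (m≤n+m (2 * D) N₀) (<⇒≤ (n<2^n r))) ⟩
      k ^ R         ∎

    4M≤size : ∀ n → ((4 * M) ^ 2 ^ n) ^ D ≤ size (n + r) ^ D
    4M≤size n = begin
      ((4 * M) ^ 2 ^ n) ^ D              ≡⟨ ^-swap (4 * M) (2 ^ n) D ⟩
      ((4 * M) ^ D) ^ 2 ^ n              ≡⟨ cong (_^ 2 ^ n) (^-distribʳ-* 4 M D) ⟩
      (4 ^ D * M ^ D) ^ 2 ^ n            ≤⟨ ^-monoˡ-≤ (2 ^ n) (*-mono-≤ 4^D≤ M^D≤H) ⟩
      (k ^ R * H) ^ 2 ^ n                ≡⟨ cong (_^ 2 ^ n) (^-distribˡ-+-* k R (p₁ * R * D₂)) ⟨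
      (k ^ (R + p₁ * R * D₂)) ^ 2 ^ n    ≤⟨ ^-monoˡ-≤ (2 ^ n) (^-monoʳ-≤ k exponent≤) ⟩
      (k ^ (p₂ * R * D₁)) ^ 2 ^ n        ≡⟨ trans (^-*-assoc k (p₂ * R * D₁) (2 ^ n)) (cong (k ^_) exponent≡) ⟩
      k ^ (p₂ * 2 ^ (n + r) * D₁)        ≡⟨ ^-*-assoc k (p₂ * 2 ^ (n + r)) D₁ ⟨
      (k ^ (p₂ * 2 ^ (n + r))) ^ D₁      ≤⟨ ^-monoˡ-≤ D₁ (fast (n + r)) ⟩
      (size (n + r) ^ D₂) ^ D₁           ≡⟨ trans (^-*-assoc (size (n + r)) D₂ D₁) (cong (size (n + r) ^_) (*-comm D₂ D₁)) ⟩
      size (n + r) ^ D                   ∎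
      where
      -- The strict inequality of the fractions leaves room for exactly one more `R`, the one spent
      -- on `4 ^ D`.
      exponent≤ : R + p₁ * R * D₂ ≤ p₂ * R * D₁
      exponent≤ = begin
        R + p₁ * R * D₂         ≡⟨ lem p₁ R D₂ ⟩
        suc (p₁ * D₂) * R       ≤⟨ *-monoˡ-≤ R p₁/d₁<p₂/d₂ ⟩
        p₂ * D₁ * R             ≡⟨ lem′ p₂ D₁ R ⟩
        p₂ * R * D₁             ∎
        where
        lem : ∀ p R d → R + p * R * d ≡ (1 + p * d) * R
        lem = solve-∀
        lem′ : ∀ p d R → p * d * R ≡ p * R * d
        lem′ = solve-∀
      exponent≡ : p₂ * R * D₁ * 2 ^ n ≡ p₂ * 2 ^ (n + r) * D₁
      exponent≡ = trans (lem p₂ R D₁ (2 ^ n)) (cong (λ v → p₂ * v * D₁) (sym (^-distribˡ-+-* 2 n r)))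
        where
        lem : ∀ p R d v → p * R * d * v ≡ p * (v * R) * d
        lem = solve-∀

  -- By submultiplicativity log ∣P_n∣ / 2 ^ n does not increase with `n`, so a lower bound passes
  -- down to smaller dimensions.
  fast-below : .{{_ : NonZero k}} → ∀ p d n r → k ^ (p * 2 ^ (n + r)) ≤ size (n + r) ^ d → k ^ (p * 2 ^ n) ≤ size n ^ d
  fast-below p d n r h = ^-cancelˡ-≤ (2 ^ r) {{m^n≢0 2 r}} (begin
    (k ^ (p * 2 ^ n)) ^ 2 ^ r     ≡⟨ trans (^-*-assoc k (p * 2 ^ n) (2 ^ r)) (cong (k ^_) (trans (*-assoc p (2 ^ n) (2 ^ r)) (cong (p *_) (sym (^-distribˡ-+-* 2 n r))))) ⟩
    k ^ (p * 2 ^ (n + r))         ≤⟨ h ⟩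
    size (n + r) ^ d              ≤⟨ ^-monoˡ-≤ d (size-submultiplicative n r) ⟩
    (size n ^ 2 ^ r) ^ d          ≡⟨ ^-swap (size n) (2 ^ r) d ⟩
    (size n ^ d) ^ 2 ^ r          ∎)
    where open ≤-Reasoning

-- Rational numbers

toℚᵘ-/ : ∀ z d → ℚ.toℚᵘ (z / suc d) ℚᵘ.≃ ℚᵘ.mkℚᵘ z d
toℚᵘ-/ z d = ℚₚ.toℚᵘ-fromℚᵘ (ℚᵘ.mkℚᵘ z d)

/-+ : ∀ a b c d → + a / suc b ℚ.+ + c / suc d ≡ + (a * suc d + c * suc b) / (suc b * suc d)
/-+ a b c d = ℚₚ.toℚᵘ-injective (begin-equality
  ℚ.toℚᵘ (+ a / suc b ℚ.+ + c / suc d)                   ≃⟨ ℚₚ.toℚᵘ-homo-+ (+ a / suc b) (+ c / suc d) ⟩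
  ℚ.toℚᵘ (+ a / suc b) ℚᵘ.+ ℚ.toℚᵘ (+ c / suc d)         ≃⟨ ℚᵘₚ.+-cong (toℚᵘ-/ (+ a) b) (toℚᵘ-/ (+ c) d) ⟩
  ℚᵘ.mkℚᵘ (+ a ℤ.* + suc d ℤ.+ + c ℤ.* + suc b) (d + b * suc d)
    ≡⟨ cong (λ z → ℚᵘ.mkℚᵘ z (d + b * suc d)) (cong₂ ℤ._+_ (sym (ℤₚ.pos-* a (suc d))) (sym (ℤₚ.pos-* c (suc b)))) ⟩
  ℚᵘ.mkℚᵘ (+ (a * suc d + c * suc b)) (d + b * suc d)    ≃⟨ toℚᵘ-/ (+ (a * suc d + c * suc b)) (d + b * suc d) ⟨
  ℚ.toℚᵘ (+ (a * suc d + c * suc b) / (suc b * suc d))   ∎)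
  where open ℚᵘₚ.≤-Reasoning

/-*ι : ∀ a b m → (+ a / suc b) ℚ.* ι m ≡ + (a * m) / suc b
/-*ι a b m = ℚₚ.toℚᵘ-injective (begin-equality
  ℚ.toℚᵘ ((+ a / suc b) ℚ.* ι m)              ≃⟨ ℚₚ.toℚᵘ-homo-* (+ a / suc b) (ι m) ⟩
  ℚ.toℚᵘ (+ a / suc b) ℚᵘ.* ℚ.toℚᵘ (ι m)      ≃⟨ ℚᵘₚ.*-cong (toℚᵘ-/ (+ a) b) (toℚᵘ-/ (+ m) 0) ⟩
  ℚᵘ.mkℚᵘ (+ a ℤ.* + m) (b * 1)               ≡⟨ cong₂ ℚᵘ.mkℚᵘ (sym (ℤₚ.pos-* a m)) (*-identityʳ b) ⟩
  ℚᵘ.mkℚᵘ (+ (a * m)) b                       ≃⟨ toℚᵘ-/ (+ (a * m)) b ⟨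
  ℚ.toℚᵘ (+ (a * m) / suc b)                  ∎)
  where open ℚᵘₚ.≤-Reasoning

/-≤ : ∀ a b c d → a * suc d ≤ c * suc b → + a / suc b ℚ.≤ + c / suc d
/-≤ a b c d h = /-mono (+ a) (suc b) (+ c) (suc d) (subst₂ ℤ._≤_ (ℤₚ.pos-* a (suc d)) (ℤₚ.pos-* c (suc b)) (ℤ.+≤+ h))

/-≡ : ∀ a b c d → a * suc d ≡ c * suc b → + a / suc b ≡ + c / suc d
/-≡ a b c d h = ℚₚ.≤-antisym (/-≤ a b c d (≤-reflexive h)) (/-≤ c d a b (≤-reflexive (sym h)))

/-< : ∀ a b c d → a * suc d < c * suc b → + a / suc b ℚ.< + c / suc d
/-< a b c d h = ℚₚ.toℚᵘ-cancel-<
  (ℚᵘₚ.<-respʳ-≃ (ℚᵘₚ.≃-sym (toℚᵘ-/ (+ c) d)) (ℚᵘₚ.<-respˡ-≃ (ℚᵘₚ.≃-sym (toℚᵘ-/ (+ a) b))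
    (ℚᵘ.*<* (subst₂ ℤ._<_ (ℤₚ.pos-* a (suc d)) (ℤₚ.pos-* c (suc b)) (ℤ.+<+ h)))))

/-<⁻¹ : ∀ a b c d → + a / suc b ℚ.< + c / suc d → a * suc d < c * suc b
/-<⁻¹ a b c d h = ≰⇒> λ cb≤ad → ℚₚ.<-irrefl refl (ℚₚ.<-≤-trans h (/-≤ c d a b cb≤ad))

/-≡⁻¹ : ∀ a b c d → + a / suc b ≡ + c / suc d → a * suc d ≡ c * suc b
/-≡⁻¹ a b c d h = ≤-antisym
  (≮⇒≥ λ lt → ℚₚ.<-irrefl (sym h) (/-< c d a b lt)) (≮⇒≥ λ lt → ℚₚ.<-irrefl h (/-< a b c d lt))

ι-suc : ∀ n → ι (suc n) ≡ ι n ℚ.+ 1ℚ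
ι-suc n = sym (trans (/-+ n 0 1 0) (cong ι (lem n)))
  where
  lem : ∀ n → n * 1 + 1 * 1 ≡ 1 + n
  lem = solve-∀

1/m*ιm : ∀ m .{{_ : NonZero m}} → (+ 1 / m) ℚ.* ι m ≡ 1ℚ
1/m*ιm (suc d) = trans (/-*ι 1 d (suc d)) (/-≡ (1 * suc d) d 1 0 (lem d))
  where
  lem : ∀ d → 1 * (1 + d) * 1 ≡ 1 * (1 + d)
  lem = solve-∀

0<ι : ∀ m .{{_ : NonZero m}} → 0ℚ ℚ.< ι m
0<ι (suc m) = /-< 0 0 (suc m) 0 (s≤s z≤n)

*ι-neg : ∀ u m .{{_ : NonZero m}} → u ℚ.< 0ℚ → u ℚ.* ι m ℚ.< 0ℚ
*ι-neg u m u<0 = subst (u ℚ.* ι m ℚ.<_) (ℚₚ.*-zeroˡ (ι m)) (ℚₚ.*-monoˡ-<-pos (ι m) {{ℚ.positive (0<ι m)}} u<0)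

sub-< : ∀ q x y → q ℚ.< x ℚ.+ y → q ℚ.- x ℚ.< y
sub-< q x y h = subst (q ℚ.- x ℚ.<_) (lem x y) (ℚₚ.+-monoˡ-< (ℚ.- x) h)
  where
  lem : ∀ x y → x ℚ.+ y ℚ.- x ≡ y
  lem = solve 2 (λ x y → x :+ y :- x := y) refl

add-< : ∀ q x y → q ℚ.- x ℚ.< y → q ℚ.< x ℚ.+ y
add-< q x y h = subst (ℚ._< x ℚ.+ y) (lem x q) (ℚₚ.+-monoʳ-< x h)
  where
  lem : ∀ x q → x ℚ.+ (q ℚ.- x) ≡ q
  lem = solve 2 (λ x q → x :+ (q :- x) := q) refl

0<- : ∀ {x y} → x ℚ.< y → 0ℚ ℚ.< y ℚ.- x
0<- {x} {y} h = subst (ℚ._< y ℚ.- x) (ℚₚ.+-inverseʳ x) (ℚₚ.+-monoˡ-< (ℚ.- x) h)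

split-< : ∀ {q X Y} → q ℚ.< X ℚ.+ Y → ∃₂ λ x y → x ℚ.< X × y ℚ.< Y × q ℚ.< x ℚ.+ y
split-< {q} {X} {Y} h =
  let x , q-Y<x , x<X = ℚₚ.<-dense (sub-< q Y X (subst (q ℚ.<_) (ℚₚ.+-comm X Y) h))
      y , q-x<y , y<Y = ℚₚ.<-dense (sub-< q x Y (subst (q ℚ.<_) (ℚₚ.+-comm Y x) (add-< q Y x q-Y<x)))
  in x , y , x<X , y<Y , add-< q x y q-x<y

-- Cuts

¬lower⇒< : ∀ x {p q} → lower x p → ¬ lower x q → p ℚ.< q
¬lower⇒< x xp ¬xq = ℚₚ.≰⇒> λ q≤p → ¬xq (downward x q≤p xp)

above : ∀ x → ∃[ q ] ¬ lower x q
above x = b ℚ.+ 1ℚ , λ h → ℚₚ.<-irrefl refl (ℚₚ.<-≤-trans b<b+1 (proj₂ (bounded x) h))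
  where
  b = proj₁ (bounded x)
  b<b+1 : b ℚ.< b ℚ.+ 1ℚ
  b<b+1 = subst (ℚ._< b ℚ.+ 1ℚ) (ℚₚ.+-identityʳ b) (ℚₚ.+-monoʳ-< b (0<ι 1))

+ᴿ-intro : ∀ x y {p q r} → lower x p → lower y q → r ℚ.< p ℚ.+ q → lower (x +ᴿ y) r
+ᴿ-intro x y xp yq r<p+q = _ , r<p+q , _ , _ , xp , yq , refl

+ᴿ-mono : ∀ x x′ y y′ → x ≤ᴿ x′ → y ≤ᴿ y′ → x +ᴿ y ≤ᴿ x′ +ᴿ y′
+ᴿ-mono _ _ _ _ x≤ y≤ (_ , lt , p , q , xp , yq , e) = _ , lt , p , q , x≤ xp , y≤ yq , e

fromℚ-intro : ∀ {p q} → p ℚ.< q → lower (fromℚ q) p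
fromℚ-intro p<q = _ , p<q , refl

fromℚ-elim : ∀ {p q} → lower (fromℚ q) p → p ℚ.< q
fromℚ-elim (_ , p<q , refl) = p<q

infixl 6 _-ᴿ_

-- Negation reverses the order, so lower approximations of the difference pair elements of `x` with
-- non-elements of `y`.
_-ᴿ_ : ℝ → ℝ → ℝ
x -ᴿ y = sup (λ d → ∃₂ λ s t → lower x s × ¬ lower y t × d ≡ s ℚ.- t)
  (_ , _ , _ , proj₂ (inhabited x) , proj₂ (above y) , refl)
  (_ , λ { (s , t , xs , ¬yt , refl) → ℚₚ.+-mono-≤ (proj₂ (bounded x) xs)
    (ℚₚ.neg-antimono-≤ (ℚₚ.<⇒≤ (¬lower⇒< y (proj₂ (inhabited y)) ¬yt))) })

module _ (m : ℕ) .{{_ : NonZero m}} (x : ℝ) where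

  private
    c = + 1 / m
    cancel : ∀ u → c ℚ.* (u ℚ.* ι m) ≡ u
    cancel u = trans (lem c u (ι m)) (trans (cong (u ℚ.*_) (1/m*ιm m)) (ℚₚ.*-identityʳ u))
      where
      lem : ∀ c u i → c ℚ.* (u ℚ.* i) ≡ u ℚ.* (c ℚ.* i)
      lem = solve 3 (λ c u i → c :* (u :* i) := u :* (c :* i)) refl
    instance
      c-pos : ℚ.Positive c
      c-pos = ℚₚ.normalize-pos 1 m
      ιm-pos : ℚ.Positive (ι m)
      ιm-pos = ℚₚ.normalize-pos m 1

  /ℕ-elim : ∀ {u} → lower (x /ℕ m) u → lower x (u ℚ.* ι m)
  /ℕ-elim {u} (_ , u<cr , r , xr , refl) = downward x
    (ℚₚ.<⇒≤ (subst (u ℚ.* ι m ℚ.<_) cr*m≡r (ℚₚ.*-monoˡ-<-pos (ι m) u<cr))) xr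
    where
    lem : ∀ c r i → c ℚ.* r ℚ.* i ≡ c ℚ.* (r ℚ.* i)
    lem = solve 3 (λ c r i → c :* r :* i := c :* (r :* i)) refl
    cr*m≡r : c ℚ.* r ℚ.* ι m ≡ r
    cr*m≡r = trans (lem c r (ι m)) (cancel r)

  /ℕ-intro : ∀ {u} → lower x (u ℚ.* ι m) → lower (x /ℕ m) u
  /ℕ-intro {u} h =
    let r , lt , xr = noMax x h
    in c ℚ.* r , subst (ℚ._< c ℚ.* r) (cancel u) (ℚₚ.*-monoʳ-<-pos c lt) , r , xr , refl

  *ℕ-/ℕ : ∀ {y} → y ≃ᴿ x /ℕ m → y *ℕ m ≃ᴿ x
  *ℕ-/ℕ {y} (y≤ , ≤y) = to , from
    where
    to : y *ℕ m ≤ᴿ x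
    to {u} (_ , u<mr , r , yr , refl) =
      downward x (ℚₚ.<⇒≤ (subst (u ℚ.<_) (ℚₚ.*-comm (ι m) r) u<mr)) (/ℕ-elim (y≤ yr))
    from : x ≤ᴿ y *ℕ m
    from xu =
      let u′ , u<u′ , xu′ = noMax x xu
      in u′ , u<u′ , c ℚ.* u′ , ≤y (/ℕ-intro (subst (lower x) (sym (trans (ℚₚ.*-comm (c ℚ.* u′) (ι m)) (eq′ {u′}))) xu′)) , sym (eq′ {u′})
      where
      lem : ∀ i c u → i ℚ.* (c ℚ.* u) ≡ c ℚ.* (u ℚ.* i)
      lem = solve 3 (λ i c u → i :* (c :* u) := c :* (u :* i)) refl
      eq′ : ∀ {u} → ι m ℚ.* (c ℚ.* u) ≡ u
      eq′ {u} = trans (lem (ι m) c u) (cancel u)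

-- Cancellation in the reals

module Classical (em : ExcludedMiddle 0ℓ) where

  -- Walk from an element of `y` in steps `e′ < e` until a known non-element is passed; excluded
  -- middle locates the step that leaves the cut.
  archimedean : ∀ y e → 0ℚ ℚ.< e → ∃₂ λ p t → lower y p × ¬ lower y t × t ℚ.< p ℚ.+ e
  archimedean y e 0<e =
    let m , in-y , ¬in-y = search n ¬y
    in _ , _ , in-y , ¬in-y , subst (ℚ._< p[ m ] ℚ.+ e) (sym (p-suc m)) (ℚₚ.+-monoʳ-< p[ m ] e′<e)
    where
    e′ p₀ b : ℚ
    e′ = proj₁ (ℚₚ.<-dense 0<e)
    0<e′ : 0ℚ ℚ.< e′
    0<e′ = proj₁ (proj₂ (ℚₚ.<-dense 0<e))
    e′<e = proj₂ (proj₂ (ℚₚ.<-dense 0<e))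
    p₀ = proj₁ (inhabited y)
    b  = proj₁ (above y)
    p[_] : ℕ → ℚ
    p[ n ] = p₀ ℚ.+ ι n ℚ.* e′

    p-suc : ∀ n → p[ suc n ] ≡ p[ n ] ℚ.+ e′
    p-suc n = trans (cong (λ i → p₀ ℚ.+ i ℚ.* e′) (ι-suc n))
      (trans (cong (p₀ ℚ.+_) (trans (ℚₚ.*-distribʳ-+ e′ (ι n) 1ℚ) (cong (ι n ℚ.* e′ ℚ.+_) (ℚₚ.*-identityˡ e′))))
        (sym (ℚₚ.+-assoc p₀ (ι n ℚ.* e′) e′)))

    search : ∀ n → ¬ lower y p[ n ] → ∃[ m ] lower y p[ m ] × ¬ lower y p[ suc m ]
    search zero ¬y = contradiction
      (subst (lower y) (sym (trans (cong (p₀ ℚ.+_) (ℚₚ.*-zeroˡ e′)) (ℚₚ.+-identityʳ p₀))) (proj₂ (inhabited y))) ¬y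
    search (suc n) ¬y with em {lower y p[ n ]}
    ... | yes in-y = n , in-y , ¬y
    ... | no ¬in-y = search n ¬in-y

    unit : ∀ e → 0ℚ ℚ.< e → ∃[ d ] ι 1 ℚ.≤ ι d ℚ.* e
    unit e@(mkℚ (+ zero) d _) h = contradiction (/-<⁻¹ 0 0 0 d (subst (0ℚ ℚ.<_) (sym (ℚₚ.↥p/↧p≡p e)) h)) (n≮n 0)
    unit e@(mkℚ -[1+ _ ] _ _) (ℚ.*<* ())
    unit e@(mkℚ (+ suc a) d _) h = suc d , subst (ι 1 ℚ.≤_)
      (trans (sym (/-*ι (suc a) d (suc d))) (trans (cong (ℚ._* ι (suc d)) (ℚₚ.↥p/↧p≡p e)) (ℚₚ.*-comm e (ι (suc d)))))
      (/-≤ 1 0 (suc a * suc d) d (subst₂ _≤_ (sym (+-identityʳ (suc d))) (sym (*-identityʳ (suc a * suc d))) (m≤m+n (suc d) (a * suc d))))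

    d B n : ℕ
    d = proj₁ (unit e′ 0<e′)
    B = ℤ.∣ ↥ (b ℚ.- p₀) ∣
    n = B * d

    ¬y : ¬ lower y p[ n ]
    ¬y h = proj₂ (above y) (downward y b≤p h)
      where
      open ℚₚ.≤-Reasoning
      lem : ∀ b p → b ≡ p ℚ.+ (b ℚ.- p)
      lem = solve 2 (λ b p → b := p :+ (b :- p)) refl
      b≤p : b ℚ.≤ p[ n ]
      b≤p = begin
        b                             ≡⟨ lem b p₀ ⟩
        p₀ ℚ.+ (b ℚ.- p₀)             ≤⟨ ℚₚ.+-monoʳ-≤ p₀ (≤∣↥∣ (b ℚ.- p₀)) ⟩
        p₀ ℚ.+ ι B                    ≡⟨ cong (p₀ ℚ.+_) (ℚₚ.*-identityʳ (ι B)) ⟨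
        p₀ ℚ.+ ι B ℚ.* ι 1            ≤⟨ ℚₚ.+-monoʳ-≤ p₀ (ℚₚ.*-monoˡ-≤-nonNeg (ι B) {{ℚ.nonNegative (0≤ι B)}} (proj₂ (unit e′ 0<e′))) ⟩
        p₀ ℚ.+ ι B ℚ.* (ι d ℚ.* e′)   ≡⟨ cong (p₀ ℚ.+_) (trans (sym (ℚₚ.*-assoc (ι B) (ι d) e′)) (cong (ℚ._* e′) (ι-* B d))) ⟩
        p[ n ]                        ∎

  +ᴿ-cancel : ∀ x y → y +ᴿ (x -ᴿ y) ≃ᴿ x
  +ᴿ-cancel x y = to , from
    where
    to : y +ᴿ (x -ᴿ y) ≤ᴿ x
    to {q} (_ , q<p+d′ , p , d′ , yp , (_ , d′<d , s , t , xs , ¬yt , refl) , refl) = downward x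
      (ℚₚ.<⇒≤ (ℚₚ.<-trans q<p+d′ (subst (p ℚ.+ d′ ℚ.<_) (lem t s) (ℚₚ.+-mono-< (¬lower⇒< y yp ¬yt) d′<d)))) xs
      where
      lem : ∀ t s → t ℚ.+ (s ℚ.- t) ≡ s
      lem = solve 2 (λ t s → t :+ (s :- t) := s) refl
    from : x ≤ᴿ y +ᴿ (x -ᴿ y)
    from {q} xq =
      let q′ , q<q′ , xq′ = noMax x xq
          p , t , yp , ¬yt , t<p+e = archimedean y (q′ ℚ.- q) (0<- q<q′)
          d , q-p<d , d<q′-t = ℚₚ.<-dense (subst₂ ℚ._<_ (lem₁ q p t) (lem₂ q p t q′) (ℚₚ.+-monoʳ-< (q ℚ.- p ℚ.- t) t<p+e))
      in +ᴿ-intro y (x -ᴿ y) yp (_ , d<q′-t , q′ , t , xq′ , ¬yt , refl) (add-< q p d q-p<d)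
      where
      lem₁ : ∀ q p t → q ℚ.- p ℚ.- t ℚ.+ t ≡ q ℚ.- p
      lem₁ = solve 3 (λ q p t → q :- p :- t :+ t := q :- p) refl
      lem₂ : ∀ q p t q′ → q ℚ.- p ℚ.- t ℚ.+ (p ℚ.+ (q′ ℚ.- q)) ≡ q′ ℚ.- t
      lem₂ = solve 4 (λ q p t q′ → q :- p :- t :+ (p :+ (q′ :- q)) := q′ :- t) refl

-- Logarithms

module Logarithm (k : ℕ) .{{_ : NonTrivial k}} where

  instance
    k≢0 : NonZero k
    k≢0 = nonTrivial⇒nonZero k

  private
    1<k : 1 < k
    1<k = nonTrivial⇒n>1 k

  log-intro : ∀ a .{{_ : NonZero a}} p d {q} → q ℚ.< + p / suc d → k ^ p ≤ a ^ suc d → lower (log k a) q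
  log-intro a p d lt h = _ , lt , p , d , refl , h

  log-neg : ∀ a .{{_ : NonZero a}} {q} → q ℚ.< 0ℚ → lower (log k a) q
  log-neg a q<0 = log-intro a 0 0 q<0 (m^n>0 a 1)

  log-lower : ∀ a .{{_ : NonZero a}} p d → lower (log k a) (+ p / suc d) → k ^ p ≤ a ^ suc d
  log-lower a p d (_ , lt , p′ , d′ , refl , h) = ^-cancelˡ-≤ (suc d′) (begin
    (k ^ p) ^ suc d′       ≡⟨ ^-*-assoc k p (suc d′) ⟩
    k ^ (p * suc d′)       ≤⟨ ^-monoʳ-≤ k (<⇒≤ (/-<⁻¹ p d p′ d′ lt)) ⟩
    k ^ (p′ * suc d)       ≡⟨ ^-*-assoc k p′ (suc d) ⟨
    (k ^ p′) ^ suc d       ≤⟨ ^-monoˡ-≤ (suc d) h ⟩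
    (a ^ suc d′) ^ suc d   ≡⟨ ^-swap a (suc d′) (suc d) ⟩
    (a ^ suc d) ^ suc d′   ∎)
    where open ≤-Reasoning

  -- If `k ^ p < a ^ suc d`, then `suc K ≤ a ^ suc d`, and the power `m = k * K` gains a whole
  -- factor `k`. So (p m + 1) / ((d + 1) m) is also admissible, and p / (d + 1) lies strictly below
  -- it.
  log-¬lower : ∀ a .{{_ : NonZero a}} p d → ¬ lower (log k a) (+ p / suc d) → a ^ suc d ≤ k ^ p
  log-¬lower a p d ¬low = ≮⇒≥ λ K<a^d → ¬low (log-intro a (suc (p * m)) (pred D)
    (/-< p d (suc (p * m)) (pred D) (subst (λ D → p * D < suc (p * m) * suc d) (sym (suc-pred D)) (begin
      suc (p * (suc d * m))    ≡⟨ cong suc (lem p (suc d) m) ⟩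
      suc (p * m * suc d)      ≤⟨ s≤s (m≤n+m (p * m * suc d) d) ⟩
      suc (p * m) * suc d      ∎)))
    (subst (λ D → k ^ suc (p * m) ≤ a ^ D) (sym (suc-pred D)) (begin
      k * k ^ (p * m)          ≡⟨ cong (k *_) (^-*-assoc k p m) ⟨
      k * K ^ m                ≤⟨ *-monoˡ-≤ (K ^ m) (n≤1+n k) ⟩
      suc k * K ^ m            ≤⟨ suc^-multiple k K ⟩
      suc K ^ m                ≤⟨ ^-monoˡ-≤ m K<a^d ⟩
      (a ^ suc d) ^ m          ≡⟨ ^-*-assoc a (suc d) m ⟩
      a ^ D                    ∎)))
    where
    open ≤-Reasoning
    K m D : ℕ
    K = k ^ p
    m = k * K
    D = suc d * m
    instance
      K≢0 : NonZero K
      K≢0 = m^n≢0 k p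
      m≢0 : NonZero m
      m≢0 = m*n≢0 k K
      D≢0 : NonZero D
      D≢0 = m*n≢0 (suc d) m
    lem : ∀ p d m → p * (d * m) ≡ p * m * d
    lem = solve-∀

  ⌊log⌋ : ∀ A .{{_ : NonZero A}} → ∃[ x ] k ^ x ≤ A × A < k ^ suc x
  ⌊log⌋ A = search A (≤-trans (n<2^n A) (^-monoˡ-≤ A 1<k))
    where
    search : ∀ b → A < k ^ b → ∃[ x ] k ^ x ≤ A × A < k ^ suc x
    search zero    A<1 = contradiction A<1 (≤⇒≯ (>-nonZero⁻¹ A))
    search (suc b) A<  with k ^ b ≤? A
    ... | yes ≤A = b , ≤A , A<
    ... | no  ≰A = search b (≰⇒> ≰A)

  log-* : ∀ a b .{{_ : NonZero a}} .{{_ : NonZero b}} .{{_ : NonZero (a * b)}} →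
          log k a +ᴿ log k b ≃ᴿ log k (a * b)
  log-* a b = to , from
    where
    open ≤-Reasoning
    to : log k a +ᴿ log k b ≤ᴿ log k (a * b)
    to {q} (_ , q<x+y , x , y , (_ , x< , p , d , refl , h) , (_ , y< , p′ , d′ , refl , h′) , refl) =
      log-intro (a * b) (p * suc d′ + p′ * suc d) (d′ + d * suc d′)
        (subst (q ℚ.<_) (/-+ p d p′ d′) (ℚₚ.<-trans q<x+y (ℚₚ.+-mono-< x< y<))) (begin
        k ^ (p * suc d′ + p′ * suc d)              ≡⟨ ^-distribˡ-+-* k (p * suc d′) (p′ * suc d) ⟩
        k ^ (p * suc d′) * k ^ (p′ * suc d)        ≡⟨ cong₂ _*_ (^-*-assoc k p (suc d′)) (^-*-assoc k p′ (suc d)) ⟨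
        (k ^ p) ^ suc d′ * (k ^ p′) ^ suc d        ≤⟨ *-mono-≤ (^-monoˡ-≤ (suc d′) h) (^-monoˡ-≤ (suc d) h′) ⟩
        (a ^ suc d) ^ suc d′ * (b ^ suc d′) ^ suc d ≡⟨ cong₂ _*_ (^-*-assoc a (suc d) (suc d′)) (trans (^-swap b (suc d′) (suc d)) (^-*-assoc b (suc d) (suc d′))) ⟩
        a ^ (suc d * suc d′) * b ^ (suc d * suc d′) ≡⟨ ^-distribʳ-* a b (suc d * suc d′) ⟨
        (a * b) ^ (suc d * suc d′)                 ∎)

    from : log k (a * b) ≤ᴿ log k a +ᴿ log k b
    -- Both logarithms contain every negative rational.
    from {mkℚ -[1+ _ ] _ _} _ =
      let x , y , x<0 , y<0 , q<x+y = split-< {X = 0ℚ} {0ℚ} (ℚ.*<* ℤ.-<+)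
      in +ᴿ-intro (log k a) (log k b) (log-neg a x<0) (log-neg b y<0) q<x+y
    from q@{mkℚ (+ z) e _} (_ , q< , p , d , refl , h) =
      let X , Y , X< , Y< , q<X+Y = split-< {q} {+ x / D} {+ y / D} (subst₂ ℚ._<_ (ℚₚ.↥p/↧p≡p q) x/D+y/D (/-< z e (x + y) D₋₁ z/e<))
      in +ᴿ-intro (log k a) (log k b) (log-intro a x D₋₁ X< x≤) (log-intro b y D₋₁ Y< y≤) q<X+Y
      where
      -- Rounding both logarithms down leaves `p * m < x + y + 2`. With `m` one more than the
      -- denominator of `q`, the gap between `q` and p / (d + 1), enlarged `m` times, exceeds this
      -- loss.
      m D D₋₁ : ℕ
      m   = suc (suc e)
      D₋₁ = suc e + d * m
      D   = suc D₋₁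
      instance
        a^D≢0 : NonZero (a ^ D)
        a^D≢0 = m^n≢0 a D
        b^D≢0 : NonZero (b ^ D)
        b^D≢0 = m^n≢0 b D
      x = proj₁ (⌊log⌋ (a ^ D))
      y = proj₁ (⌊log⌋ (b ^ D))
      x≤ = proj₁ (proj₂ (⌊log⌋ (a ^ D)))
      y≤ = proj₁ (proj₂ (⌊log⌋ (b ^ D)))

      pm< : p * m < suc x + suc y
      pm< = ≰⇒> λ sx+sy≤pm → <⇒≱ (begin-strict
        (a * b) ^ D              ≡⟨ ^-distribʳ-* a b D ⟩
        a ^ D * b ^ D            <⟨ *-mono-< (proj₂ (proj₂ (⌊log⌋ (a ^ D)))) (proj₂ (proj₂ (⌊log⌋ (b ^ D)))) ⟩
        k ^ suc x * k ^ suc y    ≡⟨ ^-distribˡ-+-* k (suc x) (suc y) ⟨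
        k ^ (suc x + suc y)      ≤⟨ ^-monoʳ-≤ k sx+sy≤pm ⟩
        k ^ (p * m)              ∎) (begin
        k ^ (p * m)              ≡⟨ ^-*-assoc k p m ⟨
        (k ^ p) ^ m              ≤⟨ ^-monoˡ-≤ m h ⟩
        ((a * b) ^ suc d) ^ m    ≡⟨ ^-*-assoc (a * b) (suc d) m ⟩
        (a * b) ^ D              ∎)

      z/e< : z * D < (x + y) * suc e
      z/e< = +-cancelʳ-≤ (suc e) _ _ (begin
        suc (z * D) + suc e             ≡⟨ lem₁ z (suc d) (suc e) ⟩
        suc (z * suc d) * m             ≤⟨ *-monoˡ-≤ m (/-<⁻¹ z e p d (subst (ℚ._< + p / suc d) (sym (ℚₚ.↥p/↧p≡p q)) q<)) ⟩
        p * suc e * m                   ≡⟨ lem₂ p (suc e) m ⟩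
        p * m * suc e                   ≤⟨ *-monoˡ-≤ (suc e) (s≤s⁻¹ (subst (p * m <_) (cong suc (+-suc x y)) pm<)) ⟩
        suc (x + y) * suc e             ≡⟨ +-comm (suc e) _ ⟩
        (x + y) * suc e + suc e         ∎)
        where
        lem₁ : ∀ z d e → 1 + z * (d * (1 + e)) + e ≡ (1 + z * d) * (1 + e)
        lem₁ = solve-∀
        lem₂ : ∀ p e m → p * e * m ≡ p * m * e
        lem₂ = solve-∀

      x/D+y/D : + (x + y) / D ≡ + x / D ℚ.+ + y / D
      x/D+y/D = sym (trans (/-+ x D₋₁ y D₋₁) (/-≡ (x * D + y * D) (D₋₁ + D₋₁ * D) (x + y) D₋₁ (lem x y D)))
        where
        lem : ∀ x y D → (x * D + y * D) * D ≡ (x + y) * (D * D)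
        lem = solve-∀

  ∏ᶜ≢0 : ∀ n (f : Cube n → ℕ) → (∀ x → NonZero (f x)) → NonZero (∏ᶜ n f)
  ∏ᶜ≢0 zero    f nz = nz []
  ∏ᶜ≢0 (suc n) f nz = m*n≢0 _ _ {{∏ᶜ≢0 n _ (nz ∘ (false ∷_))}} {{∏ᶜ≢0 n _ (nz ∘ (true ∷_))}}

  -- The summands are only required to be equivalent to logarithms, as comparing two occurrences of
  -- log with different nonzeroness proofs makes the type checker unfold both.
  ∑-log : ∀ n (g : Cube n → ℝ) (f : Cube n → ℕ) (nz : ∀ x → NonZero (f x)) .{{_ : NonZero (∏ᶜ n f)}} →
          (∀ x → g x ≃ᴿ log k (f x) {{nz x}}) → ∑ n g ≃ᴿ log k (∏ᶜ n f)
  ∑-log zero    g f nz g≃log = g≃log []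
  ∑-log (suc n) g f nz g≃log = (λ h → proj₁ lg (+ᴿ-mono S₀ L₀ S₁ L₁ (proj₁ IH₀) (proj₁ IH₁) h)) ,
    (λ h → +ᴿ-mono L₀ S₀ L₁ S₁ (proj₂ IH₀) (proj₂ IH₁) (proj₂ lg h))
    where
    instance
      nz₀ : NonZero (∏ᶜ n (f ∘ (false ∷_)))
      nz₀ = ∏ᶜ≢0 n _ (nz ∘ (false ∷_))
      nz₁ : NonZero (∏ᶜ n (f ∘ (true ∷_)))
      nz₁ = ∏ᶜ≢0 n _ (nz ∘ (true ∷_))
    S₀ = ∑ n (g ∘ (false ∷_))
    S₁ = ∑ n (g ∘ (true ∷_))
    L₀ = log k (∏ᶜ n (f ∘ (false ∷_)))
    L₁ = log k (∏ᶜ n (f ∘ (true ∷_)))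
    IH₀ = ∑-log n (g ∘ (false ∷_)) (f ∘ (false ∷_)) (nz ∘ (false ∷_)) (g≃log ∘ (false ∷_))
    IH₁ = ∑-log n (g ∘ (true ∷_)) (f ∘ (true ∷_)) (nz ∘ (true ∷_)) (g≃log ∘ (true ∷_))
    lg = log-* (∏ᶜ n (f ∘ (false ∷_))) (∏ᶜ n (f ∘ (true ∷_)))

  ^ᴿ-mono : ∀ {x y} → x ≤ᴿ y → k ^ᴿ x ≤ᴿ k ^ᴿ y
  ^ᴿ-mono x≤y (s , q<s , 0≤s , r , xr , h) = s , q<s , 0≤s , r , x≤y xr , h

  module _ (a b : ℕ) (s : ℚ) .{{_ : NonZero b}} (sb≡a : s ℚ.* ι b ≡ ι a) where

    clear-denominator : ∀ n → s ^ℚ n ℚ.* ι (b ^ n) ≡ ι (a ^ n)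
    clear-denominator zero    = refl
    clear-denominator (suc n) = begin
      s ℚ.* s ^ℚ n ℚ.* ι (b * b ^ n)              ≡⟨ cong (s ℚ.* s ^ℚ n ℚ.*_) (ι-* b (b ^ n)) ⟨
      s ℚ.* s ^ℚ n ℚ.* (ι b ℚ.* ι (b ^ n))        ≡⟨ lem s (s ^ℚ n) (ι b) (ι (b ^ n)) ⟩
      (s ℚ.* ι b) ℚ.* (s ^ℚ n ℚ.* ι (b ^ n))      ≡⟨ cong₂ ℚ._*_ sb≡a (clear-denominator n) ⟩
      ι a ℚ.* ι (a ^ n)                           ≡⟨ ι-* a (a ^ n) ⟩
      ι (a ^ suc n)                               ∎
      where
      open ≡-Reasoning
      lem : ∀ s t u v → s ℚ.* t ℚ.* (u ℚ.* v) ≡ (s ℚ.* u) ℚ.* (t ℚ.* v)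
      lem = solve 4 (λ s t u v → s :* t :* (u :* v) := (s :* u) :* (t :* v)) refl

    scaled-power-≤ : ∀ n c K → c * a ^ n ≤ K * b ^ n → ι c ℚ.* s ^ℚ n ℚ.≤ ι K
    scaled-power-≤ n c K h = ℚₚ.*-cancelʳ-≤-pos (ι (b ^ n)) {{ℚ.positive (0<ι (b ^ n) {{m^n≢0 b n}})}} (begin
      ι c ℚ.* s ^ℚ n ℚ.* ι (b ^ n)      ≡⟨ ℚₚ.*-assoc (ι c) _ _ ⟩
      ι c ℚ.* (s ^ℚ n ℚ.* ι (b ^ n))    ≡⟨ cong (ι c ℚ.*_) (clear-denominator n) ⟩
      ι c ℚ.* ι (a ^ n)                 ≡⟨ ι-* c (a ^ n) ⟩
      ι (c * a ^ n)                     ≤⟨ ι-mono h ⟩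
      ι (K * b ^ n)                     ≡⟨ ι-* K (b ^ n) ⟨
      ι K ℚ.* ι (b ^ n)                 ∎)
      where open ℚₚ.≤-Reasoning

    -- `_^ᴿ_` uses the reduced numerator and denominator of `r`, whereas the estimates produce an
    -- unreduced fraction; common powers transfer the inequality.
    power-≤-^ℤ : ∀ r x d → r ≡ + x / suc d → a ^ suc d ≤ k ^ x * b ^ suc d → s ^ℚ ↧ₙ r ℚ.≤ k ^ℤ ↥ r
    power-≤-^ℤ r@(mkℚ -[1+ _ ] _ _) x d r≡ h =
      contradiction (ℚₚ.<-≤-trans (ℚ.*<* ℤ.-<+) (/-≤ 0 0 x d z≤n)) (ℚₚ.<-irrefl r≡)
    power-≤-^ℤ r@(mkℚ (+ p) e _) x d r≡ h = subst (ℚ._≤ ι (k ^ p)) (ℚₚ.*-identityˡ _)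
      (scaled-power-≤ (suc e) 1 (k ^ p) (≤-trans (≤-reflexive (*-identityˡ _)) (^-cancelˡ-≤ (suc d) (begin
        (a ^ suc e) ^ suc d                    ≡⟨ ^-swap a (suc e) (suc d) ⟩
        (a ^ suc d) ^ suc e                    ≤⟨ ^-monoˡ-≤ (suc e) h ⟩
        (k ^ x * b ^ suc d) ^ suc e            ≡⟨ ^-distribʳ-* (k ^ x) (b ^ suc d) (suc e) ⟩
        (k ^ x) ^ suc e * (b ^ suc d) ^ suc e  ≡⟨ cong₂ _*_ (^-*-assoc k x (suc e)) (^-swap b (suc d) (suc e)) ⟩
        k ^ (x * suc e) * (b ^ suc e) ^ suc d  ≡⟨ cong (λ n → k ^ n * (b ^ suc e) ^ suc d) (/-≡⁻¹ p e x d (trans (ℚₚ.↥p/↧p≡p r) r≡)) ⟨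
        k ^ (p * suc d) * (b ^ suc e) ^ suc d  ≡⟨ cong (_* (b ^ suc e) ^ suc d) (^-*-assoc k p (suc d)) ⟨
        (k ^ p) ^ suc d * (b ^ suc e) ^ suc d  ≡⟨ ^-distribʳ-* (k ^ p) (b ^ suc e) (suc d) ⟨
        (k ^ p * b ^ suc e) ^ suc d            ∎))))
      where open ≤-Reasoning

    power-≤-1/k : ∀ n → k * a ^ n ≤ b ^ n → s ^ℚ n ℚ.≤ k ^ℤ -[1+ 0 ]
    power-≤-1/k n h = ℚₚ.*-cancelˡ-≤-pos (ι k) {{ℚ.positive (0<ι k)}} (ℚₚ.≤-trans
      (scaled-power-≤ n k 1 (≤-trans h (≤-reflexive (sym (*-identityˡ _)))))
      (ℚₚ.≤-reflexive (sym (trans (ℚₚ.*-comm (ι k) _) (trans (cong (λ j → (k ^ℤ -[1+ 0 ]) ℚ.* ι j) (sym (*-identityʳ k))) (1/m*ιm (k ^ 1) {{m^n≢0 k 1}}))))))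

  ^ᴿ-log : ∀ N .{{_ : NonZero N}} → k ^ᴿ log k N ≃ᴿ fromℕ N
  ^ᴿ-log N = to , from
    where
    to : k ^ᴿ log k N ≤ᴿ fromℕ N
    to (s , q<s , 0≤s , r , Nr , h) = fromℚ-intro (ℚₚ.<-≤-trans q<s (ℚₚ.≮⇒≥ λ N<s → ℚₚ.<-irrefl refl
      (ℚₚ.<-≤-trans (^ℚ-mono-< (0≤ι N) N<s (ℚ.ℚ.denominator-1 r)) (ℚₚ.≤-trans h (bound r Nr)))))
      where
      bound : ∀ r → lower (log k N) r → k ^ℤ ↥ r ℚ.≤ ι N ^ℚ ↧ₙ r
      bound r@(mkℚ (+ p) d _) Nr = subst (ι (k ^ p) ℚ.≤_) (sym (ι-^ N (suc d)))
        (ι-mono (log-lower N p d (subst (lower (log k N)) (sym (ℚₚ.↥p/↧p≡p r)) Nr)))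
      bound r@(mkℚ -[1+ n ] d _) Nr = subst (k ^ℤ -[1+ n ] ℚ.≤_) (sym (ι-^ N (suc d)))
        (ℚₚ.≤-trans (^ℤ-bound k -[1+ n ] 0 ℤ.-≤+) (ι-mono (m^n>0 N (suc d))))

    between : ∀ q s → q ℚ.< s → 0ℚ ℚ.< s → s ℚ.< ι N → lower (k ^ᴿ log k N) q
    between q s@(mkℚ -[1+ _ ] _ _) q<s (ℚ.*<* ()) s<N
    between q s@(mkℚ (+ zero) b _) q<s 0<s s<N =
      contradiction (/-<⁻¹ 0 0 0 b (subst (0ℚ ℚ.<_) (sym (ℚₚ.↥p/↧p≡p s)) 0<s)) (n≮n 0)
    between q s@(mkℚ (+ a@(suc _)) b₋₁ _) q<s 0<s s<N with ⌊log⌋ (N ^ (k * k * a)) {{m^n≢0 N (k * k * a)}}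
    ... | x , k^x≤ , <k^suc-x = s , q<s , ℚₚ.<⇒≤ 0<s , exponent x k^x≤ <k^suc-x
      where
      open ≤-Reasoning
      -- As `suc a ≤ N * b`, the exponent `D` gives k² s ^ D ≤ N ^ D < k ^ (x + 1), so s ^ D < k ^
      -- (x - 1). One factor `k` pays for rounding down to `x`, the other puts (x - 1) / D strictly
      -- below the logarithm.
      b D : ℕ
      b = suc b₋₁
      D = k * k * a
      instance
        kk≢0 : NonZero (k * k)
        kk≢0 = m*n≢0 k k
        D≢0 : NonZero D
        D≢0 = m*n≢0 (k * k) a
      sb≡a : s ℚ.* ι b ≡ ι a
      sb≡a = trans (cong (ℚ._* ι b) (sym (ℚₚ.↥p/↧p≡p s))) (trans (/-*ι a b₋₁ b) (/-≡ (a * b) b₋₁ a 0 (*-identityʳ _)))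
      a<Nb : a < N * b
      a<Nb = subst (_< N * b) (*-identityʳ a) (/-<⁻¹ a b₋₁ N 0 (subst (ℚ._< ι N) (sym (ℚₚ.↥p/↧p≡p s)) s<N))
      kka^D≤ : k * k * a ^ D ≤ N ^ D * b ^ D
      kka^D≤ = begin
        k * k * a ^ D         ≤⟨ *-monoˡ-≤ (a ^ D) (n≤1+n (k * k)) ⟩
        suc (k * k) * a ^ D   ≤⟨ suc^-multiple (k * k) a ⟩
        suc a ^ D             ≤⟨ ^-monoˡ-≤ D a<Nb ⟩
        (N * b) ^ D           ≡⟨ ^-distribʳ-* N b D ⟩
        N ^ D * b ^ D         ∎
      D₋₁ : ℕ
      D₋₁ = pred D
      D≡ : suc D₋₁ ≡ D
      D≡ = suc-pred D

      exponent : ∀ x → k ^ x ≤ N ^ D → N ^ D < k ^ suc x → ∃[ r ] lower (log k N) r × s ^ℚ ↧ₙ r ℚ.≤ k ^ℤ ↥ r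
      -- Here the exponent (x - 1) / D is negative, namely -1 / D.
      exponent zero _ N^D<k = mkℚ -[1+ 0 ] D₋₁ (1-coprimeTo (suc D₋₁)) , log-neg N (ℚ.*<* ℤ.-<+) ,
        power-≤-1/k a b s sb≡a (suc D₋₁) (subst (λ D → k * a ^ D ≤ b ^ D) (sym D≡) (*-cancelˡ-≤ k (begin
          k * (k * a ^ D)    ≡⟨ *-assoc k k _ ⟨
          k * k * a ^ D      ≤⟨ kka^D≤ ⟩
          N ^ D * b ^ D      ≤⟨ *-monoˡ-≤ (b ^ D) (<⇒≤ N^D<k) ⟩
          k ^ 1 * b ^ D      ≡⟨ cong (_* b ^ D) (*-identityʳ k) ⟩
          k * b ^ D          ∎)))
      exponent (suc x) k^x≤ N^D< = + x / suc D₋₁ ,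
        log-intro N (suc x) D₋₁ (/-< x D₋₁ (suc x) D₋₁ (*-monoˡ-< (suc D₋₁) (n<1+n x))) (subst (λ D → k ^ suc x ≤ N ^ D) (sym D≡) k^x≤) ,
        power-≤-^ℤ a b s sb≡a (+ x / suc D₋₁) x D₋₁ refl (subst (λ D → a ^ D ≤ k ^ x * b ^ D) (sym D≡) (*-cancelˡ-≤ (k * k) (begin
          k * k * a ^ D                ≤⟨ kka^D≤ ⟩
          N ^ D * b ^ D                ≤⟨ *-monoˡ-≤ (b ^ D) (<⇒≤ N^D<) ⟩
          k * (k * k ^ x) * b ^ D      ≡⟨ lem k (k ^ x) (b ^ D) ⟩
          k * k * (k ^ x * b ^ D)      ∎)))
        where
        lem : ∀ k y b → k * (k * y) * b ≡ k * k * (y * b)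
        lem = solve-∀

    from : fromℕ N ≤ᴿ k ^ᴿ log k N
    from {q} h with 0ℚ ℚₚ.≤? q
    ... | yes 0≤q = let s , q<s , s<N = ℚₚ.<-dense (fromℚ-elim h) in
      between q s q<s (ℚₚ.≤-<-trans 0≤q q<s) s<N
    ... | no  0≰q = let s , 0<s , s<N = ℚₚ.<-dense (0<ι N) in
      between q s (ℚₚ.<-trans (ℚₚ.≰⇒> 0≰q) 0<s) 0<s s<N

-- The entropy density

palette≢0 : ∀ {k n} (t : Template k n) x → NonZero ∣ palette t x ∣
palette≢0 t x = >-nonZero (≤-<-trans z≤n (x∈p⇒∣p-x∣<∣p∣ (proj₂ (nonempty t x))))

module EntropyDensity (em : ExcludedMiddle 0ℓ) (k : ℕ) .{{_ : NonTrivial k}} (P : Property k)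
  (her : OrderHereditary P) (ne : ∀ n → ∃ (member P n))
  (π : ℝ) (density : IsEntropyDensity P π)
  (size : ℕ → ℕ) (hasSize : ∀ n → HasSize P n (size n)) where

  open Speed em P her size hasSize
  open Classical em
  open Logarithm k

  ex = proj₁ density
  isEx = proj₁ (proj₂ density)
  ex⟶π = proj₂ (proj₂ density)

  instance
    size-nonZero : ∀ {n} → NonZero (size n)
    size-nonZero {n} = size≢0 n (ne n)

  2^n≢0 : ∀ n → NonZero (2 ^ n)
  2^n≢0 n = m^n≢0 2 n

  _/2^_ : ℝ → ℕ → ℝ
  x /2^ n = _/ℕ_ x (2 ^ n) {{2^n≢0 n}}

  /2^-intro : ∀ n x {u} → lower x (u ℚ.* ι (2 ^ n)) → lower (x /2^ n) u
  /2^-intro n = /ℕ-intro (2 ^ n) {{2^n≢0 n}}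

  /2^-elim : ∀ n x {u} → lower (x /2^ n) u → lower x (u ℚ.* ι (2 ^ n))
  /2^-elim n = /ℕ-elim (2 ^ n) {{2^n≢0 n}}

  speed : ℕ → ℝ
  speed n = log k (size n) /2^ n

  templateSize : ∀ {n} → Template k n → ℕ
  templateSize {n} t = ∏ᶜ n λ x → ∣ palette t x ∣

  templateSize≢0 : ∀ {n} (t : Template k n) → NonZero (templateSize t)
  templateSize≢0 {n} t = ∏ᶜ≢0 n (λ x → ∣ palette t x ∣) (palette≢0 t)

  Ent≃log : ∀ {n} (t : Template k n) →
    Ent t ≃ᴿ log k (templateSize t) {{templateSize≢0 t}}
  Ent≃log {n} t = ∑-log n _ (λ x → ∣ palette t x ∣) (palette≢0 t) {{templateSize≢0 t}} λ x → (λ h → h) , (λ h → h)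

  log-mono : ∀ a b .{{_ : NonZero a}} .{{_ : NonZero b}} → a ≤ b → log k a ≤ᴿ log k b
  log-mono a b a≤b (_ , q< , p , d , refl , h) = log-intro b p d q< (≤-trans h (^-monoˡ-≤ (suc d) a≤b))

  ex≤log-size : ∀ n → ex n ≤ᴿ log k (size n)
  ex≤log-size n h =
    let t , t⊆P , _ , ex≤Ent = IsEx.attained (isEx n)
    in log-mono (templateSize t) (size n) {{templateSize≢0 t}} (template≤size n t t⊆P) (proj₁ (Ent≃log t) (ex≤Ent h))

  ex-neg : ∀ n {q} → q ℚ.< 0ℚ → lower (ex n) q
  ex-neg n q<0 =
    let t , t⊆P , Ent≤ex , _ = IsEx.attained (isEx n)
    in Ent≤ex (proj₂ (Ent≃log t) (log-neg (templateSize t) {{templateSize≢0 t}} q<0))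

  scaled : ∀ {u} p d m → + p / suc d ≡ u → u ℚ.* ι m ≡ + (p * m) / suc d
  scaled p d m refl = /-*ι p d m

  -- The upper bound passes from templates to all colourings at the price of an arbitrarily small
  -- increase of the rate from `u₁` to `u`.
  speed-below : ∀ u₁ u → u₁ ℚ.< u → (∃[ N ] ∀ n → N ≤ n → ¬ lower (ex n /2^ n) u₁) →
    ∃[ N ] ∀ n → N ≤ n → ¬ lower (speed n) u
  -- A negative `u₁` always lies below the entropy of a template.
  speed-below u₁@(mkℚ -[1+ _ ] _ _) u u₁<u (N , h) =
    contradiction (/2^-intro N (ex N) (ex-neg N (*ι-neg u₁ (2 ^ N) {{2^n≢0 N}} (ℚ.*<* ℤ.-<+)))) (h N ≤-refl)
  speed-below u₁@(mkℚ (+ _) _ _) (mkℚ -[1+ _ ] _ _) u₁<u _ = contradiction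
    (ℚₚ.≤-<-trans (ℚₚ.nonNegative⁻¹ u₁) (ℚₚ.<-trans u₁<u (ℚ.*<* ℤ.-<+))) (ℚₚ.<-irrefl refl)
  speed-below u₁@(mkℚ (+ p₁) d₁ _) u@(mkℚ (+ p₂) d₂ _) u₁<u (N₀ , h) =
    -- If no threshold worked, every `n` would have some `n′ ≥ n` of rate at least `u`; `fast-below`
    -- would bring this down to `n`, giving the lower bound for all `n` that `growth-bound`
    -- excludes.
    decidable-stable em λ ¬bounded → growth-bound (λ n → size-nonZero {n}) N₀ p₁ d₁ p₂ d₂
      (/-<⁻¹ p₁ d₁ p₂ d₂ (subst₂ ℚ._<_ (sym (ℚₚ.↥p/↧p≡p u₁)) (sym (ℚₚ.↥p/↧p≡p u)) u₁<u))
      (λ r N₀≤r t t⊆P → log-¬lower (templateSize t) {{templateSize≢0 t}} (p₁ * 2 ^ r) d₁ λ low →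
        h r N₀≤r (/2^-intro r (ex r) (subst (lower (ex r)) (sym (scaled p₁ d₁ (2 ^ r) (ℚₚ.↥p/↧p≡p u₁)))
          (IsEx.upperBound (isEx r) t t⊆P (proj₂ (Ent≃log t) low)))))
      (λ n → decidable-stable (_ ≤? _) λ slow → ¬bounded (n , λ n′ n≤n′ high → slow
        (fast-below p₂ (suc d₂) n (n′ ∸ n) (subst (λ n → k ^ (p₂ * 2 ^ n) ≤ size n ^ suc d₂) (sym (m+[n∸m]≡n n≤n′))
          (log-lower (size n′) (p₂ * 2 ^ n′) d₂ (subst (lower (log k (size n′))) (scaled p₂ d₂ (2 ^ n′) (ℚₚ.↥p/↧p≡p u))
            (/2^-elim n′ (log k (size n′)) high)))))))

  -- Defined so that the formula for the size holds exactly at every `n`; only the convergence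
  -- carries content.
  o : ℕ → ℝ
  o n = speed n -ᴿ π

  o-upper : ∀ ε → 0ℚ ℚ.< ε → ∃[ N ] ∀ n → N ≤ n → o n <ᴿ fromℚ 0ℚ +ᴿ fromℚ ε
  o-upper ε 0<ε =
    -- The chain t < u₁ < u < p + ε splits the tolerance: `u₁ - t` for the convergence of `ex`,
    -- `u - u₁` for `speed-below`. As `p` is below π, `u - p` bounds `o n` and is less than ε.
    let p , t , πp , ¬πt , t<p+ε = archimedean π ε 0<ε
        u , t<u , u<p+ε = ℚₚ.<-dense t<p+ε
        u₁ , t<u₁ , u₁<u = ℚₚ.<-dense t<u
        N₀ , near = ex⟶π (u₁ ℚ.- t) (0<- t<u₁)
        N , below = speed-below u₁ u u₁<u (N₀ , λ n N₀≤n low → ex-below t u₁ ¬πt n (proj₁ (near n N₀≤n)) low)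
    in N , λ n N≤n → u ℚ.- p ,
      (λ { (_ , q<d , s , t′ , sp , ¬πt′ , refl) → ℚₚ.<-asym q<d
        (ℚₚ.+-mono-< (¬lower⇒< (speed n) sp (below n N≤n)) (ℚₚ.neg-antimono-< (¬lower⇒< π πp ¬πt′))) }) ,
      small (sub-< u p ε u<p+ε)
    where
    ex-below : ∀ t u₁ → ¬ lower π t → ∀ n → ex n /2^ n <ᴿ π +ᴿ fromℚ (u₁ ℚ.- t) → ¬ lower (ex n /2^ n) u₁
    ex-below t u₁ ¬πt n (q , ¬q , _ , q<p+e , p , e , πp , e∈ , refl) low = ¬q (downward (ex n /2^ n)
      (ℚₚ.<⇒≤ (ℚₚ.<-trans q<p+e (subst (p ℚ.+ e ℚ.<_) (lem t u₁) (ℚₚ.+-mono-< (¬lower⇒< π πp ¬πt) (fromℚ-elim e∈))))) low)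
      where
      lem : ∀ t u → t ℚ.+ (u ℚ.- t) ≡ u
      lem = solve 2 (λ t u → t :+ (u :- t) := u) refl
    small : ∀ {q} → q ℚ.< ε → lower (fromℚ 0ℚ +ᴿ fromℚ ε) q
    small {q} q<ε =
      let x , y , x<0 , y<ε , q<x+y = split-< {q} {0ℚ} {ε} (subst (q ℚ.<_) (sym (ℚₚ.+-identityˡ ε)) q<ε)
      in +ᴿ-intro (fromℚ 0ℚ) (fromℚ ε) (fromℚ-intro x<0) (fromℚ-intro y<ε) q<x+y

  -- The members of an extremal template already give a speed of at least ex(Q_n) / 2 ^ n.
  o-lower : ∀ ε n → π <ᴿ ex n /2^ n +ᴿ fromℚ ε → fromℚ 0ℚ <ᴿ o n +ᴿ fromℚ ε
  o-lower ε n (q , ¬πq , _ , q<s+e , s , e , exs , e∈ , refl) = 0ℚ , (λ h → ℚₚ.<-irrefl refl (fromℚ-elim h)) ,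
    (let x , y , x< , y< , 0<x+y = split-< {0ℚ} {s ℚ.- q} {e} (subst₂ ℚ._<_ (ℚₚ.+-inverseʳ q) (lem s e q) (ℚₚ.+-monoˡ-< (ℚ.- q) q<s+e))
     in +ᴿ-intro (o n) (fromℚ ε)
       (s ℚ.- q , x< , s , q , /2^-intro n (log k (size n)) (ex≤log-size n (/2^-elim n (ex n) exs)) , ¬πq , refl)
       (fromℚ-intro (ℚₚ.<-trans y< (fromℚ-elim e∈))) 0<x+y)
    where
    lem : ∀ s e q → s ℚ.+ e ℚ.- q ≡ (s ℚ.- q) ℚ.+ e
    lem = solve 3 (λ s e q → s :+ e :- q := (s :- q) :+ e) refl

  o⟶0 : o ⟶ fromℚ 0ℚ
  o⟶0 ε 0<ε =
    let N , upper = o-upper ε 0<ε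
        N′ , near = ex⟶π ε 0<ε
    in N ⊔ N′ , λ n h → upper n (≤-trans (m≤m⊔n N N′) h) , o-lower ε n (proj₂ (near n (≤-trans (m≤n⊔m N N′) h)))

  size≃ : ∀ n → fromℕ (size n) ≃ᴿ k ^ᴿ ((π +ᴿ o n) *ℕ (2 ^ n))
  size≃ n =
    let y≤ , ≤y = *ℕ-/ℕ (2 ^ n) {{2^n≢0 n}} (log k (size n)) {π +ᴿ o n} (+ᴿ-cancel (speed n) π)
        to , from = ^ᴿ-log (size n)
    in (λ h → ^ᴿ-mono {log k (size n)} {(π +ᴿ o n) *ℕ (2 ^ n)} ≤y (from h)) ,
       (λ h → to (^ᴿ-mono {(π +ᴿ o n) *ℕ (2 ^ n)} {log k (size n)} y≤ h))

corollary3p24 : ExcludedMiddle 0ℓ →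
    ∀ (k : ℕ) .{{_ : NonTrivial k}} (P : Property k) →
    OrderHereditary P →
    (∀ n → ∃ (member P n)) →
    ∀ (π : ℝ) → IsEntropyDensity P π →
    ∀ (size : ℕ → ℕ) → (∀ n → HasSize P n (size n)) →
    ∃[ o ] (o ⟶ fromℚ 0ℚ) ×
    (∀ n → fromℕ (size n) ≃ᴿ _^ᴿ_ k {{nonTrivial⇒nonZero k}} ((π +ᴿ o n) *ℕ (2 ^ n)))
corollary3p24 em k P her ne π density size hasSize = o , o⟶0 , size≃
  where open EntropyDensity em k P her ne π density size hasSize
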